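{- For any partitions $\lambda,\mu$, the one-variable function $\mathbb{F}_{\lambda/\mu}(\kappa\mid\Xi,\mathsf{S})$ is given as follows. If $\mu\prec\lambda$, then $$\mathbb{F}_{\lambda/\mu}(\kappa\mid\Xi,\mathsf{S})=(-\kappa)^{|\lambda|-|\mu|}\prod_{i\ge1}\xi_{i-1}^{\mu_i-\lambda_i}\Bigl(\frac{s_i\xi_i}{s_{i-1}\xi_{i-1}}\Bigr)^{\mu_i/2}\frac{(\kappa^{ -1}s_i\xi_i;q)_{\lambda_i-\mu_i}(\kappa s_i/\xi_i;q)_{\mu_i-\lambda_{i+1}}(q;q)_{\lambda_i-\lambda_{i+1}}}{(q;q)_{\lambda_i-\mu_i}(q;q)_{\mu_i-\lambda_{i+1}}(s_i^2;q)_{\lambda_i-\lambda_{i+1}}},$$ and $\mathbb{F}_{\lambda/\mu}(\kappa\mid\Xi,\mathsf{S})=0$ otherwise.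
   Context: Fix a generic parameter $q$, and write $(x;q)_n:=\prod_{i=1}^n(1-xq^{i-1})$, $(x;q)_0:=1$. A partition is a weakly decreasing sequence $\lambda=(\lambda_1\ge\lambda_2\ge\dots\ge0)$ of nonnegative integers with finitely many nonzero entries; $l(\lambda)$ is the number of nonzero parts, $|\lambda|=\sum_i\lambda_i$, and $\lambda'$ is the conjugate partition, so the number of parts of $\lambda'$ equal to $j$ is $m_j(\lambda')=\lambda_j-\lambda_{j+1}$. Write $\mu\prec\lambda$ (interlacing) if $\lambda_i\ge\mu_i\ge\lambda_{i+1}$ for all $i\ge1$. Let $\Xi=(\xi_0,\xi_1,\dots)$ and $\mathsf{S}=(s_0,s_1,\dots)$ be sequences of generic parameters, with fixed square roots $\sqrt{\xi_i},\sqrt{s_i}$; all square roots below are formed from these. Put $s_i^{(1)}:=\sqrt{s_{i+1}\xi_{i+1}s_i/\xi_i}$ and $\tau_{\Xi}\mathsf{S}:=(s^{(1)}_0,s^{(1)}_1,\dots)$. Vertex weights: for $i,j,k,l\in\mathbb{Z}_{\ge0}$ (labels of the bottom, left, top, right edge), $$W_{t,s}(i,j;k,l):=\mathbf{1}_{i+j=k+l}\,\mathbf{1}_{i\ge l}\,(s^2/t^2)^{l}\frac{(s^2/t^2;q)_{i-l}(t^2;q)_l}{(s^2;q)_i}\frac{(q;q)_i}{(q;q)_{i-l}(q;q)_l},$$ which depends only on $t^2,s^2$. For $a\in\mathbb{Z}_{\ge0}$ and $L>l(\lambda),l(\mu)$ set $$ZW^{(a)}_{\lambda/\mu}(\kappa\mid\Xi,\mathsf{S}):=\sum\prod_{c=1}^L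 W_{t_{c},\,s^{(1)}_c}(m_c(\mu'),h_{c-1};m_c(\lambda'),h_{c}),\qquad t_{c}^2=\frac{\xi_{c+1}s_{c+1}}{\kappa},$$ where the sum is over nonnegative integers $h_0,\dots,h_L$ with $h_0=a$, $h_L=0$; the result does not depend on $L$. Then $$\mathbb{F}_{\lambda/\mu}(\kappa\mid\Xi,\mathsf{S}):=\frac{(-\tau_\Xi\mathsf{S})^{\mu}}{(-\mathsf{S})^{\lambda}}\frac{\mathsf{c}_{\tau_\Xi\mathsf{S}}(\mu)}{\mathsf{c}_{\mathsf{S}}(\lambda)}\,(\kappa s_0/\xi_0)^{\lambda_1-\mu_1}\frac{(\kappa^{ -1}s_1\xi_1;q)_{\lambda_1-\mu_1}}{(q;q)_{\lambda_1-\mu_1}}\,ZW^{(\lambda_1-\mu_1)}_{\lambda/\mu}(\kappa\mid\Xi,\mathsf{S})$$ if $\lambda_1\ge\mu_1$, and $\mathbb{F}_{\lambda/\mu}(\kappa\mid\Xi,\mathsf{S}):=0$ if $\lambda_1<\mu_1$. Here $\mathsf{c}_{\mathsf{S}}(\lambda):=\prod_{i\ge1}\frac{(s_i^2;q)_{\lambda_i-\lambda_{i+1}}}{(q;q)_{\lambda_i-\lambda_{i+1}}}$ and $(-\mathsf{S})^\lambda:=\prod_{i\ge1}(-s_{i-1})^{\lambda_i}$ (and likewise with $\mathsf S$ replaced by $\tau_\Xi\mathsf S$). -}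

module Defs where

open import Level as Level using (Level)
open import Algebra.Apartness.Bundles using (HeytingField; HeytingCommutativeRing)
open import Algebra.Bundles using (CommutativeRing)
open import Data.Bool.Base using (if_then_else_)
open import Data.Empty using (⊥; ⊥-elim)
open import Data.Fin.Base using (Fin; zero; suc; toℕ; inject₁)
open import Data.Integer.Base using (ℤ; +_; -[1+_]; _⊖_)
open import Data.List.Base using (length; filter; upTo; applyUpTo)
open import Data.List.Properties using (length-filter; length-upTo; filter-none)
import Data.List.Relation.Unary.All as All
open import Data.List.Relation.Binary.Sublist.Propositional using (⊆-refl)
open import Data.List.Relation.Binary.Sublist.Heterogeneous.Properties
  using (length-mono-≤; ⊆-filter-Sublist)
open import Data.Nat.Base using (ℕ; zero; suc; _∸_; _≤_; _<_; _⊔_; s≤s; z≤n)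
  renaming (_+_ to _+ℕ_)
open import Data.Nat.ListAction using (sum)
open import Data.Nat.Properties
  using (_≟_; _≤?_; _<?_; ≤-refl; ≤-trans; ≤-reflexive; <⇒≱; ≤⇒≯;
         m≤n⇒m≤1+n; m≤m⊔n; m≤n⊔m; m≤m+n; m≤n+m)
open import Data.Product.Base using (_×_; _,_; proj₁; proj₂)
open import Data.Vec.Base using (Vec; []; _∷_; lookup; last)
open import Relation.Binary.PropositionalEquality as ≡ using (_≡_)
open import Relation.Nullary.Decidable using (Dec; yes; no; does; ¬?)
open import Relation.Unary using (Pred; Decidable)

count : ∀ {p} {P : Pred ℕ p} → Decidable P → ℕ → ℕ
count P? n = length (filter P? (upTo n))

-- Parts are indexed from 0: `part i` is λ_{i+1}.  Accordingly every product
-- over i ≥ 1 below runs over i ≥ 0, with ξ_{i-1}, s_{i-1}, s_i written as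
-- ξ i, s i, s (suc i).  The number `bound` is only
-- a witness that almost all parts vanish; it need not be the length.
record Partition : Set where
  field
    part     : ℕ → ℕ
    weakDecr : ∀ i → part (suc i) ≤ part i
    bound    : ℕ
    vanish   : ∀ i → bound ≤ i → part i ≡ 0

open Partition public

part≤part₀ : ∀ lam i → part lam i ≤ part lam 0
part≤part₀ lam zero    = ≤-refl
part≤part₀ lam (suc i) = ≤-trans (weakDecr lam i) (part≤part₀ lam i)

l : Partition → ℕ
l lam = count (λ i → ¬? (part lam i ≟ 0)) (bound lam)

size : Partition → ℕ
size lam = sum (applyUpTo (part lam) (bound lam))

conj : Partition → Partition
conj lam = record
  { part     = λ j → count (λ i → j <? part lam i) (bound lam)
  ; weakDecr = λ j → length-mono-≤
      (⊆-filter-Sublist (λ i → suc j <? part lam i) (λ i → j <? part lam i)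
        (λ { ≡.refl j<p → ≤-trans (m≤n⇒m≤1+n ≤-refl) j<p })
        (⊆-refl {x = upTo (bound lam)}))
  ; bound    = part lam 0
  ; vanish   = λ j λ₁≤j → ≡.cong length
      (filter-none (λ i → j <? part lam i)
        (All.universal (λ i → ≤⇒≯ (≤-trans (part≤part₀ lam i) λ₁≤j)) (upTo (bound lam))))
  }

-- The number of parts equal to j, meaningful for j ≥ 1 only.
m : ℕ → Partition → ℕ
m j lam = count (λ i → part lam i ≟ j) (bound lam)

m≤bound : ∀ j lam → m j lam ≤ bound lam
m≤bound j lam = ≤-trans (length-filter (λ i → part lam i ≟ j) (upTo (bound lam)))
                        (≤-reflexive (length-upTo (bound lam)))

infix 4 _≺_
_≺_ : Partition → Partition → Set
μ ≺ lam = ∀ i → part μ i ≤ part lam i × part lam (suc i) ≤ part μ i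

module FieldOps {c ℓ₁ ℓ₂ : Level} (K : HeytingField c ℓ₁ ℓ₂) where

  open HeytingField K hiding (zero)
  open CommutativeRing (HeytingCommutativeRing.commutativeRing heytingCommutativeRing)
    using (semiring; +-monoid; *-monoid; ring)
  open import Algebra.Apartness.Properties.HeytingCommutativeRing heytingCommutativeRing
    using (x-0≈x; 1#0; x#0y#0→xy#0; invertibleˡ⇒#)
  open import Algebra.Properties.Ring ring using (-‿distribˡ-*; -‿distribʳ-*; -‿involutive)
  open import Algebra.Properties.Semiring.Exp semiring public using (_^_)
  import Algebra.Properties.Monoid.Sum as MonoidSum
  open import Relation.Binary.Reasoning.Setoid setoid

  ∑F : ∀ {n} → (Fin n → Carrier) → Carrier
  ∑F = MonoidSum.sum +-monoid

  ∏F : ∀ {n} → (Fin n → Carrier) → Carrier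
  ∏F = MonoidSum.sum *-monoid

  infix 9 _⁻¹[_]
  _⁻¹[_] : ∀ x → x # 0# → Carrier
  x ⁻¹[ x#0 ] = proj₁ (#⇒invertible x#0)

  infixl 7 _/_[_]
  _/_[_] : ∀ x y → y # 0# → Carrier
  x / y [ y#0 ] = x * y ⁻¹[ y#0 ]

  infixr 8 _^ℤ_[_]
  _^ℤ_[_] : ∀ x → ℤ → x # 0# → Carrier
  x ^ℤ (+ n)    [ _   ] = x ^ n
  x ^ℤ -[1+ n ] [ x#0 ] = (x ⁻¹[ x#0 ]) ^ suc n

  *-inverseʳ : ∀ {x} (x#0 : x # 0#) → x * x ⁻¹[ x#0 ] ≈ 1#
  *-inverseʳ {x} x#0 =
    trans (*-congʳ (sym (x-0≈x x))) (proj₂ (proj₂ (#⇒invertible x#0)))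

  -- Opaque because unfolding these proofs inside ⁻¹ is very slow.
  opaque
    *#0 : ∀ {x y} → x # 0# → y # 0# → x * y # 0#
    *#0 = x#0y#0→xy#0

    ⁻¹#0 : ∀ {x} (x#0 : x # 0#) → x ⁻¹[ x#0 ] # 0#
    ⁻¹#0 {x} x#0 = invertibleˡ⇒# (x , trans (*-congˡ (x-0≈x _)) (*-inverseʳ x#0))

    /#0 : ∀ {x y} → x # 0# → (y#0 : y # 0#) → x / y [ y#0 ] # 0#
    /#0 x#0 y#0 = *#0 x#0 (⁻¹#0 y#0)

    -#0 : ∀ {x} → x # 0# → - x # 0#
    -#0 {x} x#0 = invertibleˡ⇒# (- x⁻¹ , (begin
      - x⁻¹ * (- x - 0#)  ≈⟨ *-congˡ (x-0≈x (- x)) ⟩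
      - x⁻¹ * - x         ≈⟨ -‿distribˡ-* x⁻¹ (- x) ⟨
      - (x⁻¹ * - x)       ≈⟨ -‿cong (-‿distribʳ-* x⁻¹ x) ⟨
      - (- (x⁻¹ * x))     ≈⟨ -‿involutive (x⁻¹ * x) ⟩
      x⁻¹ * x             ≈⟨ *-comm x⁻¹ x ⟩
      x * x⁻¹             ≈⟨ *-inverseʳ x#0 ⟩
      1#                  ∎))
      where
      x⁻¹ : Carrier
      x⁻¹ = x ⁻¹[ x#0 ]

    ^#0 : ∀ {x} n → x # 0# → x ^ n # 0#
    ^#0 zero    x#0 = 1#0
    ^#0 (suc n) x#0 = *#0 x#0 (^#0 n x#0)

    ∏F#0 : ∀ {n} {f : Fin n → Carrier} → (∀ i → f i # 0#) → ∏F f # 0#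
    ∏F#0 {zero}  f#0 = 1#0
    ∏F#0 {suc n} f#0 = *#0 (f#0 zero) (∏F#0 (λ i → f#0 (suc i)))

  ∏F≈0 : ∀ {n} {f : Fin n → Carrier} i → f i ≈ 0# → ∏F f ≈ 0#
  ∏F≈0 zero    fi≈0 = trans (*-congʳ fi≈0) (zeroˡ _)
  ∏F≈0 (suc i) fi≈0 = trans (*-congˡ (∏F≈0 i fi≈0)) (zeroʳ _)

  -- The product of f i over all i ≥ 0; the last argument certifies that the
  -- factors left out by stopping at N are all 1.
  ∏∞ : (f : ℕ → Carrier) (N : ℕ) → (∀ i → N ≤ i → f i ≈ 1#) → Carrier
  ∏∞ f N _ = ∏F {N} (λ i → f (toℕ i))

  ∑box : ∀ n → ℕ → (Vec ℕ n → Carrier) → Carrier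
  ∑box zero    B f = f []
  ∑box (suc n) B f = ∑F {B} (λ x → ∑box n B (λ h → f (toℕ x ∷ h)))

  -- The sum of f h over all h ∈ ℕⁿ; the last argument certifies that the
  -- terms left out by restricting to h ∈ {0,…,B-1}ⁿ are all 0.
  ∑∞ : ∀ {n} (f : Vec ℕ n → Carrier) (B : ℕ) →
       (∀ h i → B ≤ lookup h i → f h ≈ 0#) → Carrier
  ∑∞ {n} f B _ = ∑box n B f

  𝟙 : ∀ {p} {P : Set p} → Dec P → Carrier
  𝟙 P? = if does P? then 1# else 0#

  qPoch : Carrier → Carrier → ℕ → Carrier
  qPoch q x n = ∏F {n} (λ i → 1# - x * q ^ toℕ i)

-- Genericity enters only through the nonvanishing of the quantities that are
-- divided by.  The chosen square roots are the primitive data.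
record Parameters {c ℓ₁ ℓ₂ : Level} (K : HeytingField c ℓ₁ ℓ₂) : Set (c Level.⊔ ℓ₂) where
  open HeytingField K hiding (zero)
  open FieldOps K

  field
    q κ   : Carrier
    √ξ √s : ℕ → Carrier

  ξ : ℕ → Carrier
  ξ i = √ξ i * √ξ i

  s : ℕ → Carrier
  s i = √s i * √s i

  field
    κ#0  : κ # 0#
    √ξ#0 : ∀ i → √ξ i # 0#
    √s#0 : ∀ i → √s i # 0#

  τS : ℕ → Carrier
  τS i = (√s (suc i) * √ξ (suc i) * √s i) / √ξ i [ √ξ#0 i ]

  field
    qq#0  : ∀ n → qPoch q q n # 0#
    ss#0  : ∀ i n → qPoch q (s i * s i) n # 0#
    τsτs#0 : ∀ i n → qPoch q (τS i * τS i) n # 0#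

module Functions {c ℓ₁ ℓ₂ : Level} (K : HeytingField c ℓ₁ ℓ₂) (P : Parameters K) where

  open HeytingField K hiding (zero; _≈_; 0#)
  open HeytingField K public using (_≈_; 0#)
  open FieldOps K public
  open Parameters P public

  infix 8 ⟨_⟩_
  ⟨_⟩_ : Carrier → ℕ → Carrier
  ⟨ x ⟩ n = qPoch q x n

  ξ#0 : ∀ i → ξ i # 0#
  ξ#0 i = *#0 (√ξ#0 i) (√ξ#0 i)

  s#0 : ∀ i → s i # 0#
  s#0 i = *#0 (√s#0 i) (√s#0 i)

  W : (t² s² : Carrier) → t² # 0# → (∀ n → ⟨ s² ⟩ n # 0#) → (i j k l : ℕ) → Carrier
  W t² s² t²#0 s²#0 i j k l =
      𝟙 (i +ℕ j ≟ k +ℕ l) * 𝟙 (l ≤? i)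
    * ( r ^ l
      * ((⟨ r ⟩ (i ∸ l) * ⟨ t² ⟩ l) / ⟨ s² ⟩ i [ s²#0 i ])
      * (⟨ q ⟩ i / (⟨ q ⟩ (i ∸ l) * ⟨ q ⟩ l) [ *#0 (qq#0 (i ∸ l)) (qq#0 l) ]))
    where
    r : Carrier
    r = s² / t² [ t²#0 ]

  t² : ℕ → Carrier
  t² c = (ξ (suc c) * s (suc c)) / κ [ κ#0 ]

  t²#0 : ∀ c → t² c # 0#
  t²#0 c = /#0 (*#0 (ξ#0 (suc c)) (s#0 (suc c))) κ#0

  vertex : (lam μ : Partition) (c h h′ : ℕ) → Carrier
  vertex lam μ c h h′ =
    W (t² c) (τS c * τS c) (t²#0 c) (τsτs#0 c) (m c (conj μ)) h (m c (conj lam)) h′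

  -- The i-th entry of h is h_i; the entry `c : Fin L` stands for column c + 1.
  vertices : (lam μ : Partition) (L : ℕ) → Vec ℕ (suc L) → Fin L → Carrier
  vertices lam μ L h c = vertex lam μ (suc (toℕ c)) (lookup h (inject₁ c)) (lookup h (suc c))

  config : (lam μ : Partition) (a L : ℕ) → Vec ℕ (suc L) → Carrier
  config lam μ a L h =
      𝟙 (lookup h zero ≟ a) * 𝟙 (last h ≟ 0)
    * ∏F (vertices lam μ L h)

  𝟙-no : ∀ {p} {P : Set p} (P? : Dec P) → (P → ⊥) → 𝟙 P? ≈ 0#
  𝟙-no (yes p) ¬p = ⊥-elim (¬p p)
  𝟙-no (no _)  _  = refl

  0** : ∀ {x} y z → x ≈ 0# → x * y * z ≈ 0#
  0** y z x≈0 = trans (*-congʳ (trans (*-congʳ x≈0) (zeroˡ y))) (zeroˡ z)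

  *0* : ∀ x {y} z → y ≈ 0# → x * y * z ≈ 0#
  *0* x z y≈0 = trans (*-congʳ (trans (*-congˡ y≈0) (zeroʳ x))) (zeroˡ z)

  W≈0 : ∀ t² s² t²#0 s²#0 i j k l → i < l → W t² s² t²#0 s²#0 i j k l ≈ 0#
  W≈0 t² s² t²#0 s²#0 i j k l i<l =
    *0* (𝟙 (i +ℕ j ≟ k +ℕ l)) _ (𝟙-no (l ≤? i) (<⇒≱ i<l))

  vertex≈0 : ∀ lam μ c h h′ → m c (conj μ) < h′ → vertex lam μ c h h′ ≈ 0#
  vertex≈0 lam μ c h h′ =
    W≈0 (t² c) (τS c * τS c) (t²#0 c) (τsτs#0 c) (m c (conj μ)) h (m c (conj lam)) h′

  config≈0 : ∀ lam μ a L h i → suc (a +ℕ part μ 0) ≤ lookup h i → config lam μ a L h ≈ 0#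
  config≈0 lam μ a L h zero big =
    0** (𝟙 (last h ≟ 0)) _
      (𝟙-no (lookup h zero ≟ a)
        (λ h₀≡a → <⇒≱ (≤-trans (s≤s (m≤m+n a (part μ 0))) big) (≤-reflexive h₀≡a)))
  config≈0 lam μ a L h (suc c) big =
    trans (*-congˡ (∏F≈0 {L} {vertices lam μ L h} c
      (vertex≈0 lam μ j (lookup h (inject₁ c)) (lookup h (suc c)) small)))
      (zeroʳ _)
    where
    j : ℕ
    j = suc (toℕ c)
    small : m j (conj μ) < lookup h (suc c)
    small = ≤-trans (s≤s (≤-trans (m≤bound j (conj μ)) (m≤n+m (part μ 0) a))) big

  ZW : (lam μ : Partition) (a L : ℕ) → Carrier
  ZW lam μ a L = ∑∞ (config lam μ a L) (suc (a +ℕ part μ 0)) (config≈0 lam μ a L)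

  1/1 : ∀ {x y} (y#0 : y # 0#) → x ≈ 1# → y ≈ 1# → x / y [ y#0 ] ≈ 1#
  1/1 {x} {y} y#0 x≈1 y≈1 =
    trans (*-congʳ (trans x≈1 (sym y≈1))) (*-inverseʳ y#0)

  ⟨⟩≈1 : ∀ x {n} → n ≡ 0 → ⟨ x ⟩ n ≈ 1#
  ⟨⟩≈1 x ≡.refl = refl

  ^≈1 : ∀ x {n} → n ≡ 0 → x ^ n ≈ 1#
  ^≈1 x ≡.refl = refl

  ^ℤ≈1 : ∀ {x} (x#0 : x # 0#) {k} → k ≡ + 0 → x ^ℤ k [ x#0 ] ≈ 1#
  ^ℤ≈1 x#0 ≡.refl = refl

  1*1*1 : ∀ {x y z} → x ≈ 1# → y ≈ 1# → z ≈ 1# → x * y * z ≈ 1#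
  1*1*1 x≈1 y≈1 z≈1 =
    trans (*-cong (trans (*-cong x≈1 y≈1) (*-identityˡ 1#)) z≈1) (*-identityˡ 1#)

  ∸≡0 : ∀ {a} b → a ≡ 0 → a ∸ b ≡ 0
  ∸≡0 zero    ≡.refl = ≡.refl
  ∸≡0 (suc b) ≡.refl = ≡.refl

  negPowFactor : (ℕ → Carrier) → Partition → ℕ → Carrier
  negPowFactor S lam i = (- S i) ^ part lam i

  negPowFactor≈1 : ∀ S lam i → bound lam ≤ i → negPowFactor S lam i ≈ 1#
  negPowFactor≈1 S lam i N≤i = ^≈1 (- S i) (vanish lam i N≤i)

  infix 8 -[_]^_
  -[_]^_ : (ℕ → Carrier) → Partition → Carrier
  -[ S ]^ lam = ∏∞ (negPowFactor S lam) (bound lam) (negPowFactor≈1 S lam)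

  cFactor : (ℕ → Carrier) → Partition → ℕ → Carrier
  cFactor S lam i = ⟨ S (suc i) * S (suc i) ⟩ d / ⟨ q ⟩ d [ qq#0 d ]
    where d = part lam i ∸ part lam (suc i)

  cFactor≈1 : ∀ S lam i → bound lam ≤ i → cFactor S lam i ≈ 1#
  cFactor≈1 S lam i N≤i = 1/1 (qq#0 _) (⟨⟩≈1 _ d≡0) (⟨⟩≈1 _ d≡0)
    where d≡0 = ∸≡0 (part lam (suc i)) (vanish lam i N≤i)

  𝖼 : (ℕ → Carrier) → Partition → Carrier
  𝖼 S lam = ∏∞ (cFactor S lam) (bound lam) (cFactor≈1 S lam)

  -[s]^#0 : ∀ lam → -[ s ]^ lam # 0#
  -[s]^#0 lam = ∏F#0 {bound lam} (λ i → ^#0 (part lam (toℕ i)) (-#0 (s#0 (toℕ i))))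

  𝖼s#0 : ∀ lam → 𝖼 s lam # 0#
  𝖼s#0 lam = ∏F#0 {bound lam} (λ i →
    let d = part lam (toℕ i) ∸ part lam (suc (toℕ i)) in
    /#0 (ss#0 (suc (toℕ i)) d) (qq#0 d))

  -- L is the number of columns in the lattice; only L > l lam, l μ is meaningful.
  𝔽 : (L : ℕ) (lam μ : Partition) → Carrier
  𝔽 L lam μ =
    if does (part μ 0 ≤? part lam 0)
    then (-[ τS ]^ μ / -[ s ]^ lam [ -[s]^#0 lam ])
       * (𝖼 τS μ / 𝖼 s lam [ 𝖼s#0 lam ])
       * (κ * s 0 / ξ 0 [ ξ#0 0 ]) ^ a
       * (⟨ s 1 * ξ 1 / κ [ κ#0 ] ⟩ a / ⟨ q ⟩ a [ qq#0 a ])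
       * ZW lam μ a L
    else 0#
    where
    a : ℕ
    a = part lam 0 ∸ part μ 0

  -- The power (s_i ξ_i / (s_{i-1} ξ_{i-1}))^{μ_i/2} is formed with the chosen
  -- square roots.  The truncated subtractions are exact when μ ≺ lam.
  explicitFactor : (lam μ : Partition) → ℕ → Carrier
  explicitFactor lam μ i =
      ξ i ^ℤ μᵢ ⊖ λᵢ [ ξ#0 i ]
    * ((√s (suc i) * √ξ (suc i)) / (√s i * √ξ i) [ *#0 (√s#0 i) (√ξ#0 i) ]) ^ μᵢ
    * ( ( ⟨ s (suc i) * ξ (suc i) / κ [ κ#0 ] ⟩ (λᵢ ∸ μᵢ)
        * ⟨ κ * s (suc i) / ξ (suc i) [ ξ#0 (suc i) ] ⟩ (μᵢ ∸ λᵢ₊₁)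
        * ⟨ q ⟩ (λᵢ ∸ λᵢ₊₁))
      / ( ⟨ q ⟩ (λᵢ ∸ μᵢ) * ⟨ q ⟩ (μᵢ ∸ λᵢ₊₁)
        * ⟨ s (suc i) * s (suc i) ⟩ (λᵢ ∸ λᵢ₊₁))
        [ *#0 (*#0 (qq#0 (λᵢ ∸ μᵢ)) (qq#0 (μᵢ ∸ λᵢ₊₁))) (ss#0 (suc i) (λᵢ ∸ λᵢ₊₁)) ])
    where
    λᵢ μᵢ λᵢ₊₁ : ℕ
    λᵢ   = part lam i
    μᵢ   = part μ i
    λᵢ₊₁ = part lam (suc i)

  explicitFactor≈1 : ∀ lam μ i → bound lam ⊔ bound μ ≤ i → explicitFactor lam μ i ≈ 1#
  explicitFactor≈1 lam μ i N≤i =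
    trans (*-cong (trans (*-cong (^ℤ≈1 (ξ#0 i) μᵢ⊖λᵢ≡0) (^≈1 _ μᵢ≡0)) (*-identityˡ 1#))
                  (1/1 _ (1*1*1 (⟨⟩≈1 _ λᵢ∸μᵢ≡0) (⟨⟩≈1 _ μᵢ∸λᵢ₊₁≡0) (⟨⟩≈1 _ λᵢ∸λᵢ₊₁≡0))
                         (1*1*1 (⟨⟩≈1 _ λᵢ∸μᵢ≡0) (⟨⟩≈1 _ μᵢ∸λᵢ₊₁≡0) (⟨⟩≈1 _ λᵢ∸λᵢ₊₁≡0))))
          (*-identityˡ 1#)
    where
    λᵢ≡0 : part lam i ≡ 0
    λᵢ≡0 = vanish lam i (≤-trans (m≤m⊔n (bound lam) (bound μ)) N≤i)
    μᵢ≡0 : part μ i ≡ 0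
    μᵢ≡0 = vanish μ i (≤-trans (m≤n⊔m (bound lam) (bound μ)) N≤i)
    μᵢ⊖λᵢ≡0 : part μ i ⊖ part lam i ≡ + 0
    μᵢ⊖λᵢ≡0 = ≡.cong₂ _⊖_ μᵢ≡0 λᵢ≡0
    λᵢ∸μᵢ≡0 : part lam i ∸ part μ i ≡ 0
    λᵢ∸μᵢ≡0 = ∸≡0 (part μ i) λᵢ≡0
    μᵢ∸λᵢ₊₁≡0 : part μ i ∸ part lam (suc i) ≡ 0
    μᵢ∸λᵢ₊₁≡0 = ∸≡0 (part lam (suc i)) μᵢ≡0
    λᵢ∸λᵢ₊₁≡0 : part lam i ∸ part lam (suc i) ≡ 0
    λᵢ∸λᵢ₊₁≡0 = ∸≡0 (part lam (suc i)) λᵢ≡0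

  explicit : (lam μ : Partition) → Carrier
  explicit lam μ =
      (- κ) ^ℤ size lam ⊖ size μ [ -#0 κ#0 ]
    * ∏∞ (explicitFactor lam μ) (bound lam ⊔ bound μ) (explicitFactor≈1 lam μ)

module Submission where

-- Conservation at the vertices, read from left to right, forces the horizontal labels
-- h_c = λ_{c+1} - μ_{c+1}, because μ' has μ_c - μ_{c+1} parts equal to c.  These labels are
-- nonnegative and respect the constraint i ≥ l of the vertices exactly when μ ≺ λ.
-- Since (s_c^{(1)})² / t_c² = κ s_c / ξ_c, the weight in column c is A_{c+1} w_c, where
-- the edge factor A_c, unlike the column factor w_c, depends on λ and μ through λ_c - μ_c
-- only.  The boundary factor of 𝔽 is A_1 and A_{L+1} = 1, so A_1 ∏ A_{c+1} w_c = ∏ A_c w_c,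
-- which is compared with the claimed formula factor by factor.

open import Defs
open import Algebra.Apartness.Bundles using (HeytingField; HeytingCommutativeRing)
open import Algebra.Bundles using (CommutativeRing)
import Algebra.Properties.CommutativeMonoid.Sum as CommutativeMonoidSum
import Algebra.Properties.CommutativeSemiring.Exp as Exp
import Algebra.Properties.Monoid.Sum as MonoidSum
import Algebra.Properties.Ring as RingProperties
import Algebra.Solver.CommutativeMonoid as CommutativeMonoidSolver
open import Data.Bool.Base using (if_then_else_)
open import Data.Fin.Base as Fin using (Fin; fromℕ; fromℕ<; toℕ; inject₁)
open import Data.Fin.Induction using (<-weakInduction)
open import Data.Fin.Properties
  using (toℕ-inject₁; toℕ-fromℕ; toℕ-fromℕ<; toℕ-injective; ¬∀⟶∃¬)
open import Data.Integer.Base using (_⊖_)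
open import Data.Integer.Properties using ([1+m]⊖[1+n]≡m⊖n)
open import Data.List.Base as List using (length; filter; upTo; applyUpTo)
open import Data.List.Properties
  using (length-++; upTo-∷ʳ; filter-++; filter-accept; filter-reject; length-filter; length-upTo)
open import Data.Nat.Base as ℕ using (ℕ; zero; suc; _∸_; _≤_; _<_; _⊔_; _⊓_; z≤n; s≤s)
open import Data.Nat.ListAction using (sum)
open import Data.Nat.Properties
  using (_≟_; _≤?_; _<?_; ≤-refl; ≤-trans; ≤-reflexive; ≤-antisym; ≤-pred; ≤-total; <-irrefl;
         <⇒≤; ≤⇒≯; ≮⇒≥; ≰⇒>; n≤1+n; m≤n⇒m≤1+n; m≤n⇒m<n∨m≡n; m<1+n⇒m<n∨m≡n; n≢0⇒n>0; n≤0⇒n≡0;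
         m≤n+m; m∸n≤m; m∸n+n≡m; m+n∸n≡m; m+[n∸m]≡n; ∸-+-assoc; ∸-monoˡ-≤; ⊔-lub; m≤n⊔m;
         ⊔-identityʳ; m≤n⇒m⊔n≡n; m≥n⇒m⊔n≡m; m≤n⇒m⊓n≡m; m≥n⇒m⊓n≡n;
         +-cancelˡ-≡; +-cancelʳ-≡; +-monoˡ-≤; module ≤-Reasoning)
import Data.Nat.Properties as ℕ
open import Data.Product.Base using (_×_; ∃; _,_; proj₁; proj₂; uncurry)
open import Data.Sum.Base using (inj₁; inj₂)
open import Data.Vec.Base using (Vec; []; _∷_; lookup; last; tabulate)
open import Data.Vec.Properties using (∷-injective; lookup∘tabulate; tabulate∘lookup; tabulate-cong)
open import Function.Base using (_∘_)
open import Relation.Binary.PropositionalEquality as ≡ using (_≡_; _≢_)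
open import Relation.Nullary.Decidable using (Dec; yes; no; does; ¬?; _×-dec_)
open import Relation.Nullary.Negation using (¬_; contradiction)
open import Relation.Unary using (Pred; Decidable)

-- Multiplicities of conjugate partitions

module _ {p} {Q : Pred ℕ p} (Q? : Decidable Q) where

  count-suc : ∀ n → count Q? (suc n) ≡ count Q? n ℕ.+ length (filter Q? List.[ n ])
  count-suc n = begin
    length (filter Q? (upTo (suc n)))
      ≡⟨ ≡.cong (length ∘ filter Q?) (upTo-∷ʳ n) ⟨
    length (filter Q? (upTo n List.++ List.[ n ]))
      ≡⟨ ≡.cong length (filter-++ Q? (upTo n) List.[ n ]) ⟩
    length (filter Q? (upTo n) List.++ filter Q? List.[ n ])
      ≡⟨ length-++ (filter Q? (upTo n)) ⟩
    count Q? n ℕ.+ length (filter Q? List.[ n ]) ∎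
    where open ≡.≡-Reasoning

  count-accept : ∀ {n} → Q n → count Q? (suc n) ≡ suc (count Q? n)
  count-accept {n} Qn = ≡.trans (count-suc n)
    (≡.trans (≡.cong (λ xs → count Q? n ℕ.+ length xs) (filter-accept Q? Qn)) (ℕ.+-comm _ 1))

  count-reject : ∀ {n} → ¬ Q n → count Q? (suc n) ≡ count Q? n
  count-reject {n} ¬Qn = ≡.trans (count-suc n)
    (≡.trans (≡.cong (λ xs → count Q? n ℕ.+ length xs) (filter-reject Q? ¬Qn)) (ℕ.+-identityʳ _))

  count≤ : ∀ n → count Q? n ≤ n
  count≤ n = ≤-trans (length-filter Q? (upTo n)) (≤-reflexive (length-upTo n))

  module _ {a b : ℕ} (Q⇒ : ∀ {i} → Q i → a ≤ i × i < b) (⇒Q : ∀ {i} → a ≤ i → i < b → Q i) where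

    -- The right side clamps `n` to the interval from `a` to `b`; it grows at step `n` exactly when
    -- `a ≤ n < b`, which is when the count grows. Adding `a` on the left avoids truncated
    -- subtraction.
    count-interval : a ≤ b → ∀ n → count Q? n ℕ.+ a ≡ (a ⊔ n) ⊓ b
    count-interval a≤b zero = ≡.sym (≡.trans (≡.cong (_⊓ b) (⊔-identityʳ a)) (m≤n⇒m⊓n≡m a≤b))
    count-interval a≤b (suc n) with Q? n
    ... | yes Qn = begin
      count Q? (suc n) ℕ.+ a    ≡⟨ ≡.cong (ℕ._+ a) (count-accept Qn) ⟩
      suc (count Q? n ℕ.+ a)    ≡⟨ ≡.cong suc (count-interval a≤b n) ⟩
      suc ((a ⊔ n) ⊓ b)         ≡⟨ ≡.cong (λ x → suc (x ⊓ b)) (m≤n⇒m⊔n≡n a≤n) ⟩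
      suc (n ⊓ b)               ≡⟨ ≡.cong suc (m≤n⇒m⊓n≡m (<⇒≤ n<b)) ⟩
      suc n                     ≡⟨ m≤n⇒m⊓n≡m n<b ⟨
      suc n ⊓ b                 ≡⟨ ≡.cong (_⊓ b) (m≤n⇒m⊔n≡n (m≤n⇒m≤1+n a≤n)) ⟨
      (a ⊔ suc n) ⊓ b           ∎
      where
      open ≡.≡-Reasoning
      a≤n : a ≤ n
      a≤n = proj₁ (Q⇒ Qn)
      n<b : n < b
      n<b = proj₂ (Q⇒ Qn)
    ... | no ¬Qn = ≡.trans (≡.cong (ℕ._+ a) (count-reject ¬Qn)) (≡.trans (count-interval a≤b n) stays)
      -- Here `n` lies outside the interval, so the clamped value already sits at an end: at `b` if
      -- `a ≤ n`, at `a` otherwise.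
      where
      stays : (a ⊔ n) ⊓ b ≡ (a ⊔ suc n) ⊓ b
      stays with a ≤? n
      ... | yes a≤n = ≡.trans (m≥n⇒m⊓n≡n (≤-trans b≤n (m≤n⊔m a n)))
                            (≡.sym (m≥n⇒m⊓n≡n (≤-trans (m≤n⇒m≤1+n b≤n) (m≤n⊔m a (suc n)))))
        where
        b≤n : b ≤ n
        b≤n = ≮⇒≥ (¬Qn ∘ ⇒Q a≤n)
      ... | no a≰n = ≡.cong (_⊓ b)
        (≡.trans (m≥n⇒m⊔n≡m (<⇒≤ (≰⇒> a≰n))) (≡.sym (m≥n⇒m⊔n≡m (≰⇒> a≰n))))

  module _ (down : ∀ {i} → Q (suc i) → Q i) where

    down-≤ : ∀ {i j} → i ≤ j → Q j → Q i
    down-≤ {zero} {zero}  _   Qj = Qj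
    down-≤ {i} {suc j} i≤1+j Qj with m≤n⇒m<n∨m≡n i≤1+j
    ... | inj₁ (s≤s i≤j) = down-≤ i≤j (down Qj)
    ... | inj₂ ≡.refl    = Qj

    count-full : ∀ {n} → Q n → count Q? n ≡ n
    count-full {zero}  _  = ≡.refl
    count-full {suc n} Qn = ≡.trans (count-accept (down Qn)) (≡.cong suc (count-full (down Qn)))

    -- A downward closed `Q` is counted along an initial segment of the naturals, so comparing `k`
    -- with the count decides `Q k`; `⇒<count` is the converse for `k < n`.
    <count⇒ : ∀ n {k} → k < count Q? n → Q k
    <count⇒ (suc n) {k} k< with Q? n
    ... | yes Qn = down-≤ (≤-pred (≤-trans k< (count≤ (suc n)))) Qn
    ... | no ¬Qn = <count⇒ n (≤-trans k< (≤-reflexive (count-reject ¬Qn)))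

    ⇒<count : ∀ n {k} → k < n → Q k → k < count Q? n
    ⇒<count (suc n) {k} k<1+n Qk with Q? n
    ... | yes Qn = ≤-trans k<1+n
      (≤-reflexive (≡.sym (≡.trans (count-accept Qn) (≡.cong suc (count-full Qn)))))
    ... | no ¬Qn with m<1+n⇒m<n∨m≡n k<1+n
    ...   | inj₁ k<n    = ≤-trans (⇒<count n k<n Qk) (≤-reflexive (≡.sym (count-reject ¬Qn)))
    ...   | inj₂ ≡.refl = contradiction Qk ¬Qn

<bound : ∀ lam {i k} → k < part lam i → i < bound lam
<bound lam {i} k< = ≰⇒> λ N≤i → contradiction (≤-trans k< (≤-reflexive (vanish lam i N≤i))) λ ()

module _ (lam : Partition) (k : ℕ) where

  -- Together with `⇒<conj` this is the reflection of the Young diagram: the box in row `k` and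
  -- column `i`, both counted from 0, lies in one diagram iff its transpose lies in the other. Weak
  -- decrease supplies the downward closure.
  <conj⇒ : ∀ {i} → k < part (conj lam) i → i < part lam k
  <conj⇒ {i} = <count⇒ (λ j → i <? part lam j) (λ {j} i< → ≤-trans i< (weakDecr lam j)) (bound lam)

  ⇒<conj : ∀ {i} → i < part lam k → k < part (conj lam) i
  ⇒<conj {i} i< = ⇒<count (λ j → i <? part lam j) (λ {j} i<′ → ≤-trans i<′ (weakDecr lam j))
    (bound lam) (<bound lam i<) i<

-- By the reflection, the indices at which the conjugate takes the value `suc j` form the interval
-- from `part lam (suc j)` up to, but excluding, `part lam j`. The count stops at `part lam 0`,
-- which is beyond this interval.
m-conj : ∀ lam j → m (suc j) (conj lam) ℕ.+ part lam (suc j) ≡ part lam j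
m-conj lam j = begin
  m (suc j) (conj lam) ℕ.+ part lam (suc j)
    ≡⟨ count-interval (λ i → part (conj lam) i ≟ suc j) in-block block (weakDecr lam j) (part lam 0) ⟩
  (part lam (suc j) ⊔ part lam 0) ⊓ part lam j
    ≡⟨ m≥n⇒m⊓n≡n (≤-trans (part≤part₀ lam j) (m≤n⊔m (part lam (suc j)) (part lam 0))) ⟩
  part lam j ∎
  where
  open ≡.≡-Reasoning
  in-block : ∀ {i} → part (conj lam) i ≡ suc j → part lam (suc j) ≤ i × i < part lam j
  in-block eq = ≮⇒≥ (λ i< → <-irrefl (≡.sym eq) (⇒<conj lam (suc j) i<))
              , <conj⇒ lam j (≤-reflexive (≡.sym eq))
  block : ∀ {i} → part lam (suc j) ≤ i → i < part lam j → part (conj lam) i ≡ suc j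
  block ≤i i< = ≤-antisym (≮⇒≥ (λ j< → ≤⇒≯ ≤i (<conj⇒ lam (suc j) j<))) (⇒<conj lam j i<)

-- The indices of nonzero parts form an initial segment, and `l lam` is its length.
l≤⇒vanish : ∀ lam i → l lam ≤ i → part lam i ≡ 0
l≤⇒vanish lam i l≤i with part lam i ≟ 0
... | yes ≡0 = ≡0
... | no  ≢0 = contradiction
  (⇒<count (λ j → ¬? (part lam j ≟ 0)) (λ {j} → pos {j}) (bound lam) (<bound lam (n≢0⇒n>0 ≢0)) ≢0)
  (≤⇒≯ l≤i)
  where
  pos : ∀ {j} → ¬ part lam (suc j) ≡ 0 → ¬ part lam j ≡ 0
  pos {j} ≢0′ ≡0 = ≢0′ (n≤0⇒n≡0 (≤-trans (weakDecr lam j) (≤-reflexive ≡0)))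

-- The factors of all products depend on `part` only, so after this change of bound the
-- triviality certificates for the partition apply from N on.
rebound : (lam : Partition) (N : ℕ) → l lam < N → Partition
rebound lam N l<N = record lam
  { bound  = N
  ; vanish = λ i N≤i → l≤⇒vanish lam i (≤-trans (<⇒≤ l<N) N≤i)
  }

last-lookup : ∀ {a} {A : Set a} {n} (xs : Vec A (suc n)) → last xs ≡ lookup xs (fromℕ n)
last-lookup (x ∷ [])     = ≡.refl
last-lookup (x ∷ y ∷ xs) = last-lookup (y ∷ xs)

-- Products, sums and quotients in a Heyting field

module FieldProperties {c ℓ₁ ℓ₂} (K : HeytingField c ℓ₁ ℓ₂) where

  open HeytingField K hiding (zero)
  open FieldOps K
  open CommutativeRing (HeytingCommutativeRing.commutativeRing heytingCommutativeRing)
    using (+-commutativeMonoid; *-commutativeMonoid; *-monoid; +-monoid; commutativeSemiring; ring)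
  open Exp commutativeSemiring public using (^-congˡ; ^-homo-*; ^-distrib-*)
  open RingProperties ring public using (-‿distribˡ-*; -‿distribʳ-*; -‿involutive)
  open CommutativeMonoidSolver *-commutativeMonoid public using (solve; _⊜_; _⊕_)
  open import Relation.Binary.Reasoning.Setoid setoid

  ≡⇒≈ : ∀ {x y} → x ≡ y → x ≈ y
  ≡⇒≈ ≡.refl = refl

  *-inverseˡ : ∀ {x} (x#0 : x # 0#) → x ⁻¹[ x#0 ] * x ≈ 1#
  *-inverseˡ x#0 = trans (*-comm _ _) (*-inverseʳ x#0)

  ⁻¹-unique : ∀ {x y} (x#0 : x # 0#) → y * x ≈ 1# → x ⁻¹[ x#0 ] ≈ y
  ⁻¹-unique {x} {y} x#0 yx≈1 = begin
    x⁻¹              ≈⟨ *-identityˡ x⁻¹ ⟨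
    1# * x⁻¹         ≈⟨ *-congʳ yx≈1 ⟨
    y * x * x⁻¹      ≈⟨ *-assoc y x x⁻¹ ⟩
    y * (x * x⁻¹)    ≈⟨ *-congˡ (*-inverseʳ x#0) ⟩
    y * 1#           ≈⟨ *-identityʳ y ⟩
    y                ∎
    where
    x⁻¹ : Carrier
    x⁻¹ = x ⁻¹[ x#0 ]

  -- Uniqueness of inverses also removes the dependence on the apartness proof, so the two proofs
  -- may differ.
  ⁻¹-cong : ∀ {x y} {x#0 : x # 0#} {y#0 : y # 0#} → x ≈ y → x ⁻¹[ x#0 ] ≈ y ⁻¹[ y#0 ]
  ⁻¹-cong {x#0 = x#0} {y#0} x≈y = ⁻¹-unique x#0 (trans (*-congˡ x≈y) (*-inverseˡ y#0))

  /-cong : ∀ {x x′ y y′} {y#0 : y # 0#} {y′#0 : y′ # 0#} →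
           x ≈ x′ → y ≈ y′ → x / y [ y#0 ] ≈ x′ / y′ [ y′#0 ]
  /-cong x≈x′ y≈y′ = *-cong x≈x′ (⁻¹-cong y≈y′)

  ⁻¹-* : ∀ {x y} {xy#0 : x * y # 0#} (x#0 : x # 0#) (y#0 : y # 0#) →
         (x * y) ⁻¹[ xy#0 ] ≈ x ⁻¹[ x#0 ] * y ⁻¹[ y#0 ]
  ⁻¹-* {x} {y} {xy#0} x#0 y#0 = ⁻¹-unique xy#0 (begin
    x⁻¹ * y⁻¹ * (x * y)
      ≈⟨ solve 4 (λ a b c d → (a ⊕ b) ⊕ (c ⊕ d) ⊜ (a ⊕ c) ⊕ (b ⊕ d)) refl x⁻¹ y⁻¹ x y ⟩
    x⁻¹ * x * (y⁻¹ * y)    ≈⟨ *-cong (*-inverseˡ x#0) (*-inverseˡ y#0) ⟩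
    1# * 1#                ≈⟨ *-identityˡ 1# ⟩
    1#                     ∎)
    where
    x⁻¹ y⁻¹ : Carrier
    x⁻¹ = x ⁻¹[ x#0 ]
    y⁻¹ = y ⁻¹[ y#0 ]

  ⁻¹-/ : ∀ {x y} {y#0 : y # 0#} {x/y#0 : x / y [ y#0 ] # 0#} (x#0 : x # 0#) →
         (x / y [ y#0 ]) ⁻¹[ x/y#0 ] ≈ y / x [ x#0 ]
  ⁻¹-/ {x} {y} {y#0} {x/y#0} x#0 = ⁻¹-unique x/y#0 (begin
    y * x⁻¹ * (x * y⁻¹)
      ≈⟨ solve 4 (λ a b c d → (a ⊕ b) ⊕ (c ⊕ d) ⊜ (a ⊕ d) ⊕ (b ⊕ c)) refl y x⁻¹ x y⁻¹ ⟩
    y * y⁻¹ * (x⁻¹ * x)    ≈⟨ *-cong (*-inverseʳ y#0) (*-inverseˡ x#0) ⟩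
    1# * 1#                ≈⟨ *-identityˡ 1# ⟩
    1#                     ∎)
    where
    x⁻¹ y⁻¹ : Carrier
    x⁻¹ = x ⁻¹[ x#0 ]
    y⁻¹ = y ⁻¹[ y#0 ]

  /-*-cancel : ∀ {x y} (y#0 : y # 0#) → x / y [ y#0 ] * y ≈ x
  /-*-cancel y#0 = trans (*-assoc _ _ _) (trans (*-congˡ (*-inverseˡ y#0)) (*-identityʳ _))

  *-cancelʳ : ∀ {x y z} → z # 0# → x * z ≈ y * z → x ≈ y
  *-cancelʳ {x} {y} {z} z#0 xz≈yz = begin
    x                    ≈⟨ undo x ⟨
    x * z * z ⁻¹[ z#0 ]  ≈⟨ *-congʳ xz≈yz ⟩
    y * z * z ⁻¹[ z#0 ]  ≈⟨ undo y ⟩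
    y                    ∎
    where
    undo : ∀ w → w * z * z ⁻¹[ z#0 ] ≈ w
    undo w = trans (*-assoc _ _ _) (trans (*-congˡ (*-inverseʳ z#0)) (*-identityʳ w))

  -- Multiplying back by `x ^ b` characterises the integer power without regard to the sign of the
  -- exponent.
  ^ℤ-⊖ : ∀ {x} (x#0 : x # 0#) a b → x ^ℤ a ⊖ b [ x#0 ] * x ^ b ≈ x ^ a
  ^ℤ-⊖ x#0 a       zero    = *-identityʳ _
  ^ℤ-⊖ {x} x#0 zero (suc b) = begin
    x⁻¹ ^ suc b * x ^ suc b  ≈⟨ ^-distrib-* x⁻¹ x (suc b) ⟨
    (x⁻¹ * x) ^ suc b        ≈⟨ ^-congˡ (suc b) (*-inverseˡ x#0) ⟩
    1# ^ suc b               ≈⟨ 1^ (suc b) ⟩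
    1#                       ∎
    where
    x⁻¹ : Carrier
    x⁻¹ = x ⁻¹[ x#0 ]
    1^ : ∀ n → 1# ^ n ≈ 1#
    1^ zero    = refl
    1^ (suc n) = trans (*-identityˡ _) (1^ n)
  ^ℤ-⊖ {x} x#0 (suc a) (suc b) = begin
    x ^ℤ suc a ⊖ suc b [ x#0 ] * (x * x ^ b)
      ≡⟨ ≡.cong (λ k → x ^ℤ k [ x#0 ] * (x * x ^ b)) ([1+m]⊖[1+n]≡m⊖n a b) ⟩
    x ^ℤ a ⊖ b [ x#0 ] * (x * x ^ b)
      ≈⟨ solve 3 (λ u v w → u ⊕ (v ⊕ w) ⊜ v ⊕ (u ⊕ w)) refl _ x (x ^ b) ⟩
    x * (x ^ℤ a ⊖ b [ x#0 ] * x ^ b)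
      ≈⟨ *-congˡ (^ℤ-⊖ x#0 a b) ⟩
    x * x ^ a ∎

  ∏F-cong : ∀ {n} {f g : Fin n → Carrier} → (∀ i → f i ≈ g i) → ∏F f ≈ ∏F g
  ∏F-cong = MonoidSum.sum-cong-≋ *-monoid

  ∏F-* : ∀ {n} (f g : Fin n → Carrier) → ∏F (λ i → f i * g i) ≈ ∏F f * ∏F g
  ∏F-* = CommutativeMonoidSum.∑-distrib-+ *-commutativeMonoid

  ∏F-/ : ∀ {n} (f g : Fin n → Carrier) (g#0 : ∀ i → g i # 0#) (∏g#0 : ∏F g # 0#) →
         ∏F f / ∏F g [ ∏g#0 ] ≈ ∏F (λ i → f i / g i [ g#0 i ])
  ∏F-/ f g g#0 ∏g#0 = *-cancelʳ ∏g#0 (begin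
    ∏F f / ∏F g [ ∏g#0 ] * ∏F g                ≈⟨ /-*-cancel ∏g#0 ⟩
    ∏F f                                       ≈⟨ ∏F-cong (λ i → /-*-cancel (g#0 i)) ⟨
    ∏F (λ i → f i / g i [ g#0 i ] * g i)       ≈⟨ ∏F-* (λ i → f i / g i [ g#0 i ]) g ⟩
    ∏F (λ i → f i / g i [ g#0 i ]) * ∏F g      ∎)

  ∏ℕ : ℕ → (ℕ → Carrier) → Carrier
  ∏ℕ n f = ∏F {n} (f ∘ toℕ)

  ∏ℕ-extend : ∀ {f M N} → M ≤ N → (∀ i → M ≤ i → f i ≈ 1#) → ∏ℕ M f ≈ ∏ℕ N f
  ∏ℕ-extend {N = zero}  z≤n       _   = refl
  ∏ℕ-extend {N = suc N} z≤n       f≈1 = begin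
    1#              ≈⟨ *-identityˡ 1# ⟨
    1# * 1#         ≈⟨ *-cong (f≈1 0 z≤n) (sym (∏ℕ-extend {N = N} z≤n λ i _ → f≈1 (suc i) z≤n)) ⟨
    _ * _           ∎
  ∏ℕ-extend (s≤s M≤N) f≈1 = *-congˡ (∏ℕ-extend M≤N λ i M≤i → f≈1 (suc i) (s≤s M≤i))

  -- This brings products that are cut off at different bounds to the common bound `L`.
  ∏∞-irrelevant : ∀ f {M N} p q → ∏∞ f M p ≈ ∏∞ f N q
  ∏∞-irrelevant f {M} {N} p q with ≤-total M N
  ... | inj₁ M≤N = ∏ℕ-extend M≤N p
  ... | inj₂ N≤M = sym (∏ℕ-extend N≤M q)

  -- Nothing cancels: each edge factor moves over by one column, `A 0` enters the product on one
  -- side and `A n` leaves it on the other.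
  ∏ℕ-telescope : ∀ n (A w : ℕ → Carrier) →
                 A 0 * ∏ℕ n (λ i → A (suc i) * w i) ≈ ∏ℕ n (λ i → A i * w i) * A n
  ∏ℕ-telescope zero    A w = *-comm (A 0) 1#
  ∏ℕ-telescope (suc n) A w = begin
    A 0 * (A 1 * w 0 * ∏ℕ n (λ i → A (2 ℕ.+ i) * w (suc i)))
      ≈⟨ solve 4 (λ a b c d → a ⊕ ((b ⊕ c) ⊕ d) ⊜ (a ⊕ c) ⊕ (b ⊕ d)) refl _ _ _ _ ⟩
    A 0 * w 0 * (A 1 * ∏ℕ n (λ i → A (2 ℕ.+ i) * w (suc i)))
      ≈⟨ *-congˡ (∏ℕ-telescope n (A ∘ suc) (w ∘ suc)) ⟩
    A 0 * w 0 * (∏ℕ n (λ i → A (suc i) * w (suc i)) * A (suc n))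
      ≈⟨ *-assoc _ _ _ ⟨
    A 0 * w 0 * ∏ℕ n (λ i → A (suc i) * w (suc i)) * A (suc n) ∎

  ^-sum : ∀ x p n → x ^ sum (applyUpTo p n) ≈ ∏ℕ n (λ i → x ^ p i)
  ^-sum x p zero    = refl
  ^-sum x p (suc n) = trans (^-homo-* x (p 0) _) (*-congˡ (^-sum x (p ∘ suc) n))

  ∑F-zero : ∀ {n} {f : Fin n → Carrier} → (∀ i → f i ≈ 0#) → ∑F f ≈ 0#
  ∑F-zero {zero}  _   = refl
  ∑F-zero {suc n} f≈0 = trans (+-cong (f≈0 Fin.zero) (∑F-zero (f≈0 ∘ Fin.suc))) (+-identityˡ 0#)

  ∑F-single : ∀ {n} {f : Fin n → Carrier} k → (∀ i → i ≢ k → f i ≈ 0#) → ∑F f ≈ f k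
  ∑F-single Fin.zero    f≈0 = trans (+-congˡ (∑F-zero λ i → f≈0 (Fin.suc i) λ ())) (+-identityʳ _)
  ∑F-single (Fin.suc k) f≈0 =
    trans (+-cong (f≈0 Fin.zero λ ())
                  (∑F-single k λ i i≢k → f≈0 (Fin.suc i) λ { ≡.refl → i≢k ≡.refl }))
          (+-identityˡ _)

  ∑box-zero : ∀ n {B} {f : Vec ℕ n → Carrier} → (∀ h → f h ≈ 0#) → ∑box n B f ≈ 0#
  ∑box-zero zero    f≈0 = f≈0 []
  ∑box-zero (suc n) {B} f≈0 = ∑F-zero {B} (λ x → ∑box-zero n (λ h → f≈0 (toℕ x ∷ h)))

  ∑box-single : ∀ {n B} {f : Vec ℕ n → Carrier} v → (∀ i → lookup v i < B) →
                (∀ h → h ≢ v → f h ≈ 0#) → ∑box n B f ≈ f v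
  ∑box-single []      _   _   = refl
  ∑box-single {suc n} {B} {f} (k ∷ v) v<B f≈0 = begin
    ∑F {B} (λ x → ∑box n B (λ h → f (toℕ x ∷ h)))
      ≈⟨ ∑F-single (fromℕ< k<B) (λ x x≢k → ∑box-zero n (λ h →
           f≈0 _ (λ eq → x≢k (same x (proj₁ (∷-injective eq)))))) ⟩
    ∑box n B (λ h → f (toℕ (fromℕ< k<B) ∷ h))
      ≡⟨ ≡.cong (λ j → ∑box n B (λ h → f (j ∷ h))) (toℕ-fromℕ< k<B) ⟩
    ∑box n B (λ h → f (k ∷ h))
      ≈⟨ ∑box-single v (v<B ∘ Fin.suc) (λ h h≢v → f≈0 _ (h≢v ∘ proj₂ ∘ ∷-injective)) ⟩
    f (k ∷ v) ∎
    where
    k<B : k < B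
    k<B = v<B Fin.zero
    same : ∀ x → toℕ x ≡ k → x ≡ fromℕ< k<B
    same x eq = toℕ-injective (≡.trans eq (≡.sym (toℕ-fromℕ< k<B)))

  ∑∞-zero : ∀ {n} {f : Vec ℕ n → Carrier} {B} p → (∀ h → f h ≈ 0#) → ∑∞ f B p ≈ 0#
  ∑∞-zero {n} p f≈0 = ∑box-zero n f≈0

  ∑∞-single : ∀ {n} {f : Vec ℕ n → Carrier} {B} p v → (∀ h → h ≢ v → f h ≈ 0#) →
              (∀ i → lookup v i < B) → ∑∞ f B p ≈ f v
  ∑∞-single p v f≈0 v<B = ∑box-single v v<B f≈0

  𝟙-yes : ∀ {p} {P : Set p} (P? : Dec P) → P → 𝟙 P? ≈ 1#
  𝟙-yes (yes _) _ = refl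
  𝟙-yes (no ¬p) p = contradiction p ¬p

  qPoch-cong : ∀ {q x y} n → x ≈ y → qPoch q x n ≈ qPoch q y n
  qPoch-cong n x≈y = ∏F-cong {n} (λ i → +-congˡ (-‿cong (*-congʳ x≈y)))

  if-yes : ∀ {p} {P : Set p} (P? : Dec P) {x y : Carrier} → P → (if does P? then x else y) ≈ x
  if-yes (yes _) _ = refl
  if-yes (no ¬p) p = contradiction p ¬p

  if-cases : ∀ {p} {P : Set p} (P? : Dec P) {x y z : Carrier} → (P → x ≈ z) → y ≈ z →
             (if does P? then x else y) ≈ z
  if-cases (yes p) x≈z _ = x≈z p
  if-cases (no _)  _ y≈z = y≈z

  -- The powers in factor `i`, with `u` the part of μ and `a ℕ.+ u` that of λ; `S`, `T`, `k` stand
  -- for `- s i`, `- τS i`, `- κ`. After clearing the denominators, `T ^ u` splits into powers of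
  -- `D` and `S`, and `y ^ a * ξ ^ a` into powers of `k` and `S`.
  power-identity : ∀ {S ξ k T D y} a u (S#0 : S # 0#) (ξ#0 : ξ # 0#)
                   {Sᵃ⁺ᵘ#0 : S ^ (a ℕ.+ u) # 0#} → T ≈ D * S → y * ξ ≈ k * S →
                   T ^ u / S ^ (a ℕ.+ u) [ Sᵃ⁺ᵘ#0 ] * y ^ a
                   ≈ k ^ a * (ξ ^ℤ u ⊖ (a ℕ.+ u) [ ξ#0 ] * D ^ u)
  power-identity {S} {ξ} {k} {T} {D} {y} a u S#0 ξ#0 {Sᵃ⁺ᵘ#0} T≈DS yξ≈kS =
    *-cancelʳ (*#0 Sᵃ⁺ᵘ#0 (^#0 (a ℕ.+ u) ξ#0)) (begin
      Q * y ^ a * (S ^ (a ℕ.+ u) * ξ ^ (a ℕ.+ u))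
        ≈⟨ solve 4 (λ α β γ δ → (α ⊕ β) ⊕ (γ ⊕ δ) ⊜ (α ⊕ γ) ⊕ (β ⊕ δ)) refl _ _ _ _ ⟩
      Q * S ^ (a ℕ.+ u) * (y ^ a * ξ ^ (a ℕ.+ u))
        ≈⟨ *-cong (/-*-cancel Sᵃ⁺ᵘ#0) (*-congˡ (^-homo-* ξ a u)) ⟩
      T ^ u * (y ^ a * (ξ ^ a * ξ ^ u))
        ≈⟨ *-cong (^-*-cong u T≈DS) (*-assoc _ _ _) ⟨
      D ^ u * S ^ u * (y ^ a * ξ ^ a * ξ ^ u)
        ≈⟨ *-congˡ (*-congʳ (trans (sym (^-distrib-* y ξ a)) (sym (^-*-cong a yξ≈kS)))) ⟩
      D ^ u * S ^ u * (k ^ a * S ^ a * ξ ^ u)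
        ≈⟨ solve 5 (λ α β γ δ ε → (α ⊕ β) ⊕ ((γ ⊕ δ) ⊕ ε) ⊜ (γ ⊕ (ε ⊕ α)) ⊕ (δ ⊕ β)) refl _ _ _ _ _ ⟩
      k ^ a * (ξ ^ u * D ^ u) * (S ^ a * S ^ u)
        ≈⟨ *-cong (*-congˡ (*-congʳ (^ℤ-⊖ ξ#0 u (a ℕ.+ u)))) (^-homo-* S a u) ⟨
      k ^ a * (X * ξ ^ (a ℕ.+ u) * D ^ u) * S ^ (a ℕ.+ u)
        ≈⟨ solve 5 (λ α β γ δ ε → (α ⊕ ((β ⊕ γ) ⊕ δ)) ⊕ ε ⊜ (α ⊕ (β ⊕ δ)) ⊕ (ε ⊕ γ)) refl _ _ _ _ _ ⟩
      k ^ a * (X * D ^ u) * (S ^ (a ℕ.+ u) * ξ ^ (a ℕ.+ u)) ∎)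
    where
    Q X : Carrier
    Q = T ^ u / S ^ (a ℕ.+ u) [ Sᵃ⁺ᵘ#0 ]
    X = ξ ^ℤ u ⊖ (a ℕ.+ u) [ ξ#0 ]
    ^-*-cong : ∀ {x y z} n → x ≈ y * z → y ^ n * z ^ n ≈ x ^ n
    ^-*-cong {x} {y} {z} n x≈yz = trans (sym (^-distrib-* y z n)) (^-congˡ n (sym x≈yz))

  -- The Pochhammer symbols in one factor. Those coming from `𝖼 τS μ`, namely `t` and `d′`, cancel
  -- against the vertex weight; `s` and `d` come from `𝖼 s lam`.
  poch-identity : ∀ {t d′ s d P a R e} {t#0 : t # 0#} {d′#0 : d′ # 0#} {d#0 : d # 0#}
                  {a#0 : a # 0#} {e#0 : e # 0#} {s/d#0 : s / d [ d#0 ] # 0#}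
                  {aes#0 : a * e * s # 0#} (s#0 : s # 0#) →
                  (t / d′ [ d′#0 ]) / (s / d [ d#0 ]) [ s/d#0 ]
                    * (P / a [ a#0 ] * ((R / t [ t#0 ]) * (d′ / e [ e#0 ])))
                  ≈ (P * R * d) / (a * e * s) [ aes#0 ]
  poch-identity {t} {d′} {s} {d} {P} {a} {R} {e} {t#0} {d′#0} {d#0} {a#0} {e#0} {s/d#0} {aes#0} s#0 =
    begin
    t * d′⁻¹ * (s / d [ d#0 ]) ⁻¹[ s/d#0 ] * (P * a⁻¹ * ((R * t⁻¹) * (d′ * e⁻¹)))
      ≈⟨ *-congʳ (*-congˡ (⁻¹-/ s#0)) ⟩
    t * d′⁻¹ * (d * s⁻¹) * (P * a⁻¹ * ((R * t⁻¹) * (d′ * e⁻¹)))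
      ≈⟨ solve 10 (λ t t⁻¹ d′ d′⁻¹ d s⁻¹ P a⁻¹ R e⁻¹ →
           ((t ⊕ d′⁻¹) ⊕ (d ⊕ s⁻¹)) ⊕ ((P ⊕ a⁻¹) ⊕ ((R ⊕ t⁻¹) ⊕ (d′ ⊕ e⁻¹)))
           ⊜ ((t ⊕ t⁻¹) ⊕ (d′ ⊕ d′⁻¹)) ⊕ (((P ⊕ R) ⊕ d) ⊕ ((a⁻¹ ⊕ e⁻¹) ⊕ s⁻¹))) refl
           t t⁻¹ d′ d′⁻¹ d s⁻¹ P a⁻¹ R e⁻¹ ⟩
    t * t⁻¹ * (d′ * d′⁻¹) * (P * R * d * (a⁻¹ * e⁻¹ * s⁻¹))
      ≈⟨ *-cong (trans (*-cong (*-inverseʳ t#0) (*-inverseʳ d′#0)) (*-identityˡ 1#))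
           (*-congˡ (sym (trans (⁻¹-* (*#0 a#0 e#0) s#0) (*-congʳ (⁻¹-* a#0 e#0))))) ⟩
    1# * ((P * R * d) / (a * e * s) [ aes#0 ])
      ≈⟨ *-identityˡ _ ⟩
    (P * R * d) / (a * e * s) [ aes#0 ] ∎
    where
    t⁻¹ d′⁻¹ s⁻¹ a⁻¹ e⁻¹ : Carrier
    t⁻¹ = t ⁻¹[ t#0 ]
    d′⁻¹ = d′ ⁻¹[ d′#0 ]
    s⁻¹ = s ⁻¹[ s#0 ]
    a⁻¹ = a ⁻¹[ a#0 ]
    e⁻¹ = e ⁻¹[ e#0 ]

-- The configuration of the lattice

-- Conservation carries the invariant "label plus part of μ is part of λ" across a column: `p`, `p′`
-- are consecutive parts of μ, and `r`, `r′` of λ.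
flow-step : ∀ {p p′ r r′ h h′ m n} → m ℕ.+ p′ ≡ p → n ℕ.+ r′ ≡ r → m ℕ.+ h ≡ n ℕ.+ h′ →
            h ℕ.+ p ≡ r → h′ ℕ.+ p′ ≡ r′
flow-step {p} {p′} {r} {r′} {h} {h′} {m} {n} mp nr mh hp = +-cancelˡ-≡ n _ _ (begin
  n ℕ.+ (h′ ℕ.+ p′)    ≡⟨ ℕ.+-assoc n h′ p′ ⟨
  n ℕ.+ h′ ℕ.+ p′      ≡⟨ ≡.cong (ℕ._+ p′) mh ⟨
  m ℕ.+ h ℕ.+ p′       ≡⟨ ≡.cong (ℕ._+ p′) (ℕ.+-comm m h) ⟩
  h ℕ.+ m ℕ.+ p′       ≡⟨ ℕ.+-assoc h m p′ ⟩
  h ℕ.+ (m ℕ.+ p′)     ≡⟨ ≡.cong (h ℕ.+_) mp ⟩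
  h ℕ.+ p              ≡⟨ hp ⟩
  r                    ≡⟨ nr ⟨
  n ℕ.+ r′             ∎)
  where open ≡.≡-Reasoning

-- The conditions tested by the indicators in `config` and in the vertex weights; `capacity` is the
-- constraint i ≥ l.
record Admissible (lam μ : Partition) (L : ℕ) (h : Vec ℕ (suc L)) : Set where
  field
    start    : lookup h Fin.zero ≡ part lam 0 ∸ part μ 0
    end      : last h ≡ 0
    conserve : ∀ (c : Fin L) → m (suc (toℕ c)) (conj μ) ℕ.+ lookup h (inject₁ c)
                             ≡ m (suc (toℕ c)) (conj lam) ℕ.+ lookup h (Fin.suc c)
    capacity : ∀ (c : Fin L) → lookup h (Fin.suc c) ≤ m (suc (toℕ c)) (conj μ)

-- The horizontal labels of the only configuration with nonzero weight.
flow : (lam μ : Partition) (L : ℕ) → Vec ℕ (suc L)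
flow lam μ L = tabulate (λ i → part lam (toℕ i) ∸ part μ (toℕ i))

lookup-flow : ∀ lam μ L i → lookup (flow lam μ L) i ≡ part lam (toℕ i) ∸ part μ (toℕ i)
lookup-flow lam μ L = lookup∘tabulate _

module _ {lam μ : Partition} {L : ℕ} {h : Vec ℕ (suc L)}
         (μ₀≤λ₀ : part μ 0 ≤ part lam 0) (adm : Admissible lam μ L h) where

  open Admissible adm

  admissible-sum : ∀ i → lookup h i ℕ.+ part μ (toℕ i) ≡ part lam (toℕ i)
  admissible-sum = <-weakInduction _
    (≡.trans (≡.cong (ℕ._+ part μ 0) start) (m∸n+n≡m μ₀≤λ₀))
    (λ c ih → flow-step (m-conj μ (toℕ c)) (m-conj lam (toℕ c)) (conserve c)
      (≡.subst (λ j → lookup h (inject₁ c) ℕ.+ part μ j ≡ part lam j) (toℕ-inject₁ c) ih))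

  admissible⇒flow : h ≡ flow lam μ L
  admissible⇒flow = ≡.trans (≡.sym (tabulate∘lookup h)) (tabulate-cong λ i →
    ≡.trans (≡.sym (m+n∸n≡m (lookup h i) (part μ (toℕ i))))
            (≡.cong (_∸ part μ (toℕ i)) (admissible-sum i)))

  -- Nonnegative labels give `part μ i ≤ part lam i`, and `capacity` gives
  -- `part lam (suc i) ≤ part μ i`. Past the last column the smaller side vanishes, because `L`
  -- exceeds both lengths.
  admissible⇒≺ : l lam < L → l μ < L → μ ≺ lam
  admissible⇒≺ lλ<L lμ<L i = below i , above i
    where
    below : ∀ i → part μ i ≤ part lam i
    below i with i <? suc L
    ... | yes i<1+L = ≡.subst (λ j → part μ j ≤ part lam j) (toℕ-fromℕ< i<1+L)
      (≤-trans (m≤n+m _ _) (≤-reflexive (admissible-sum (fromℕ< i<1+L))))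
    ... | no  i≮1+L = ≤-trans (≤-reflexive (l≤⇒vanish μ i (≤-trans (<⇒≤ lμ<L)
                        (≤-trans (n≤1+n L) (≮⇒≥ i≮1+L))))) z≤n
    above : ∀ i → part lam (suc i) ≤ part μ i
    above i with i <? L
    ... | yes i<L = ≡.subst (λ j → part lam (suc j) ≤ part μ j) (toℕ-fromℕ< i<L) (begin
      part lam (suc (toℕ c))                                ≡⟨ admissible-sum (Fin.suc c) ⟨
      lookup h (Fin.suc c) ℕ.+ part μ (suc (toℕ c))         ≤⟨ +-monoˡ-≤ _ (capacity c) ⟩
      m (suc (toℕ c)) (conj μ) ℕ.+ part μ (suc (toℕ c))     ≡⟨ m-conj μ (toℕ c) ⟩
      part μ (toℕ c)                                        ∎)
      where
      open ≤-Reasoning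
      c : Fin L
      c = fromℕ< i<L
    ... | no i≮L = ≤-trans (≤-reflexive (l≤⇒vanish lam (suc i) (≤-trans (<⇒≤ lλ<L)
                     (m≤n⇒m≤1+n (≮⇒≥ i≮L))))) z≤n

m-conj-∸ : ∀ lam j → m (suc j) (conj lam) ≡ part lam j ∸ part lam (suc j)
m-conj-∸ lam j = ≡.trans (≡.sym (m+n∸n≡m _ (part lam (suc j))))
                         (≡.cong (_∸ part lam (suc j)) (m-conj lam j))

-- Conservation at a vertex of `flow`: under interlacing both sides are the exact difference of `r`
-- and `p′`.
∸-conserve : ∀ {p p′ r r′} → p′ ≤ p → p ≤ r → p′ ≤ r′ → r′ ≤ r →
             (p ∸ p′) ℕ.+ (r ∸ p) ≡ (r ∸ r′) ℕ.+ (r′ ∸ p′)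
∸-conserve {p} {p′} {r} {r′} p′≤p p≤r p′≤r′ r′≤r = +-cancelʳ-≡ p′ _ _ (begin
  (p ∸ p′) ℕ.+ (r ∸ p) ℕ.+ p′      ≡⟨ ≡.cong (ℕ._+ p′) (ℕ.+-comm (p ∸ p′) (r ∸ p)) ⟩
  (r ∸ p) ℕ.+ (p ∸ p′) ℕ.+ p′      ≡⟨ ℕ.+-assoc (r ∸ p) (p ∸ p′) p′ ⟩
  (r ∸ p) ℕ.+ ((p ∸ p′) ℕ.+ p′)    ≡⟨ ≡.cong ((r ∸ p) ℕ.+_) (m∸n+n≡m p′≤p) ⟩
  (r ∸ p) ℕ.+ p                    ≡⟨ m∸n+n≡m p≤r ⟩
  r                                ≡⟨ m∸n+n≡m r′≤r ⟨
  (r ∸ r′) ℕ.+ r′                  ≡⟨ ≡.cong ((r ∸ r′) ℕ.+_) (m∸n+n≡m p′≤r′) ⟨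
  (r ∸ r′) ℕ.+ ((r′ ∸ p′) ℕ.+ p′)  ≡⟨ ℕ.+-assoc (r ∸ r′) (r′ ∸ p′) p′ ⟨
  (r ∸ r′) ℕ.+ (r′ ∸ p′) ℕ.+ p′    ∎)
  where open ≡.≡-Reasoning

∸-∸-cancel : ∀ {p p′ r′} → p′ ≤ r′ → (p ∸ p′) ∸ (r′ ∸ p′) ≡ p ∸ r′
∸-∸-cancel {p} {p′} {r′} p′≤r′ = ≡.trans (∸-+-assoc p p′ (r′ ∸ p′)) (≡.cong (p ∸_) (m+[n∸m]≡n p′≤r′))

-- Vertex weights

module _ {c ℓ₁ ℓ₂} (K : HeytingField c ℓ₁ ℓ₂) (P : Parameters K) where

  open HeytingField K hiding (zero; _≈_; 0#)
  open Functions K P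
  open FieldProperties K
  open import Relation.Binary.Reasoning.Setoid setoid

  W-blocked : ∀ t²c s²c t²#0 s²#0 i j k h → ¬ (i ℕ.+ j ≡ k ℕ.+ h × h ≤ i) →
              W t²c s²c t²#0 s²#0 i j k h ≈ 0#
  W-blocked t²c s²c t²#0 s²#0 i j k h blocked with h ≤? i
  ... | no  h≰i = W≈0 t²c s²c t²#0 s²#0 i j k h (≰⇒> h≰i)
  ... | yes h≤i = 0** (𝟙 (h ≤? i)) _ (𝟙-no (i ℕ.+ j ≟ k ℕ.+ h) (λ eq → blocked (eq , h≤i)))

  inadmissible⇒config≈0 : ∀ lam μ L h → ¬ Admissible lam μ L h →
                          config lam μ (part lam 0 ∸ part μ 0) L h ≈ 0#
  inadmissible⇒config≈0 lam μ L h ¬adm = cases (lookup h Fin.zero ≟ a) (last h ≟ 0)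
    where
    a : ℕ
    a = part lam 0 ∸ part μ 0
    Local : Fin L → Set
    Local c = m (suc (toℕ c)) (conj μ) ℕ.+ lookup h (inject₁ c)
                ≡ m (suc (toℕ c)) (conj lam) ℕ.+ lookup h (Fin.suc c)
            × lookup h (Fin.suc c) ≤ m (suc (toℕ c)) (conj μ)
    local? : ∀ c → Dec (Local c)
    local? c = (_ ≟ _) ×-dec (_ ≤? _)
    blocked-vertex : ∀ c → ¬ Local c → vertices lam μ L h c ≈ 0#
    blocked-vertex c = W-blocked (t² i) (τS i * τS i) (t²#0 i) (τsτs#0 i)
        (m i (conj μ)) (lookup h (inject₁ c)) (m i (conj lam)) (lookup h (Fin.suc c))
      where
      i : ℕ
      i = suc (toℕ c)
    cases : Dec (lookup h Fin.zero ≡ a) → Dec (last h ≡ 0) → config lam μ a L h ≈ 0#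
    cases (no ¬start) _ = 0** (𝟙 (last h ≟ 0)) _ (𝟙-no (lookup h Fin.zero ≟ a) ¬start)
    cases (yes _) (no ¬end) = *0* (𝟙 (lookup h Fin.zero ≟ a)) _ (𝟙-no (last h ≟ 0) ¬end)
    cases (yes start) (yes end) =
      trans (*-congˡ (∏F≈0 {L} {vertices lam μ L h} (proj₁ failure)
                       (uncurry blocked-vertex failure)))
            (zeroʳ _)
      where
      -- The local conditions are decidable and the columns finitely many, so a failure yields a
      -- specific column, whose zero weight kills the product.
      failure : ∃ λ c → ¬ Local c
      failure = ¬∀⟶∃¬ L Local local? λ loc → ¬adm record
        { start = start ; end = end ; conserve = proj₁ ∘ loc ; capacity = proj₂ ∘ loc }

  W-cong-≡ : ∀ {t²c s²c t²#0 s²#0 i i′ j j′ k k′ h h′} → i ≡ i′ → j ≡ j′ → k ≡ k′ → h ≡ h′ →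
             W t²c s²c t²#0 s²#0 i j k h ≡ W t²c s²c t²#0 s²#0 i′ j′ k′ h′
  W-cong-≡ ≡.refl ≡.refl ≡.refl ≡.refl = ≡.refl

  -- The weight is regrouped so that the first two factors involve the right label `h` only; they
  -- become the edge factor, and the rest becomes the column factor.
  W-value : ∀ {t²c s²c ρ} t²#0 s²#0 {i j k h e} → s²c / t²c [ t²#0 ] ≈ ρ →
            i ℕ.+ j ≡ k ℕ.+ h → h ≤ i → i ∸ h ≡ e →
            W t²c s²c t²#0 s²#0 i j k h
            ≈ ρ ^ h * (⟨ t²c ⟩ h / ⟨ q ⟩ h [ qq#0 h ])
              * ((⟨ ρ ⟩ e / ⟨ s²c ⟩ i [ s²#0 i ]) * (⟨ q ⟩ i / ⟨ q ⟩ e [ qq#0 e ]))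
  W-value {t²c} {s²c} {ρ} t²#0 s²#0 {i} {j} {k} {h} r≈ρ conserves fits ≡.refl = begin
    𝟙 (i ℕ.+ j ≟ k ℕ.+ h) * 𝟙 (h ≤? i) * weight
      ≈⟨ *-congʳ (*-cong (𝟙-yes (i ℕ.+ j ≟ k ℕ.+ h) conserves) (𝟙-yes (h ≤? i) fits)) ⟩
    1# * 1# * weight
      ≈⟨ trans (*-congʳ (*-identityˡ 1#)) (*-identityˡ _) ⟩
    weight
      ≈⟨ *-cong (*-cong (^-congˡ h r≈ρ) (*-congʳ (*-congʳ (qPoch-cong e r≈ρ))))
                (*-congˡ (⁻¹-* (qq#0 e) (qq#0 h))) ⟩
    ρ ^ h * (⟨ ρ ⟩ e * ⟨ t²c ⟩ h * S⁻¹) * (⟨ q ⟩ i * (qe⁻¹ * qh⁻¹))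
      ≈⟨ solve 7 (λ ρʰ R T S⁻¹ Q qe⁻¹ qh⁻¹ →
           (ρʰ ⊕ ((R ⊕ T) ⊕ S⁻¹)) ⊕ (Q ⊕ (qe⁻¹ ⊕ qh⁻¹))
           ⊜ (ρʰ ⊕ (T ⊕ qh⁻¹)) ⊕ ((R ⊕ S⁻¹) ⊕ (Q ⊕ qe⁻¹))) refl
           (ρ ^ h) (⟨ ρ ⟩ e) (⟨ t²c ⟩ h) S⁻¹ (⟨ q ⟩ i) qe⁻¹ qh⁻¹ ⟩
    ρ ^ h * (⟨ t²c ⟩ h * qh⁻¹) * ((⟨ ρ ⟩ e * S⁻¹) * (⟨ q ⟩ i * qe⁻¹)) ∎
    where
    e : ℕ
    e = i ∸ h
    r weight S⁻¹ qe⁻¹ qh⁻¹ : Carrier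
    r = s²c / t²c [ t²#0 ]
    weight = r ^ h * ((⟨ r ⟩ e * ⟨ t²c ⟩ h) / ⟨ s²c ⟩ i [ s²#0 i ])
             * (⟨ q ⟩ i / (⟨ q ⟩ e * ⟨ q ⟩ h) [ *#0 (qq#0 e) (qq#0 h) ])
    S⁻¹ = (⟨ s²c ⟩ i) ⁻¹[ s²#0 i ]
    qe⁻¹ = (⟨ q ⟩ e) ⁻¹[ qq#0 e ]
    qh⁻¹ = (⟨ q ⟩ h) ⁻¹[ qq#0 h ]

  κs/ξ : ℕ → Carrier
  κs/ξ i = κ * s i / ξ i [ ξ#0 i ]

  -- Squaring removes the roots, and the product of `ξ (suc i)` and `s (suc i)` cancels between
  -- numerator and denominator.
  τ²/t² : ∀ i → (τS i * τS i) / t² i [ t²#0 i ] ≈ κs/ξ i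
  τ²/t² i = begin
    (√s′ * √ξ′ * √s i * x) * (√s′ * √ξ′ * √s i * x) * (t² i) ⁻¹[ t²#0 i ]
      ≈⟨ *-congˡ (⁻¹-/ ξs#0) ⟩
    (√s′ * √ξ′ * √s i * x) * (√s′ * √ξ′ * √s i * x) * (κ * y)
      ≈⟨ solve 6 (λ s′ ξ′ σ x κ y →
           ((((s′ ⊕ ξ′) ⊕ σ) ⊕ x) ⊕ (((s′ ⊕ ξ′) ⊕ σ) ⊕ x)) ⊕ (κ ⊕ y)
           ⊜ (((ξ′ ⊕ ξ′) ⊕ (s′ ⊕ s′)) ⊕ y) ⊕ ((κ ⊕ (σ ⊕ σ)) ⊕ (x ⊕ x))) refl √s′ √ξ′ (√s i) x κ y ⟩
    ξ (suc i) * s (suc i) * y * (κ * s i * (x * x))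
      ≈⟨ *-cong (*-inverseʳ ξs#0) (*-congˡ (sym (⁻¹-* (√ξ#0 i) (√ξ#0 i)))) ⟩
    1# * κs/ξ i
      ≈⟨ *-identityˡ _ ⟩
    κs/ξ i ∎
    where
    ξs#0 : ξ (suc i) * s (suc i) # 0#
    ξs#0 = *#0 (ξ#0 (suc i)) (s#0 (suc i))
    √s′ √ξ′ x y : Carrier
    √s′ = √s (suc i)
    √ξ′ = √ξ (suc i)
    x = √ξ i ⁻¹[ √ξ#0 i ]
    y = (ξ (suc i) * s (suc i)) ⁻¹[ ξs#0 ]

  √sξ-ratio : ℕ → Carrier
  √sξ-ratio i = (√s (suc i) * √ξ (suc i)) / (√s i * √ξ i) [ *#0 (√s#0 i) (√ξ#0 i) ]

  -- The half-integer powers in the claimed formula arise here.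
  -τ≈ratio*-s : ∀ i → - τS i ≈ √sξ-ratio i * - s i
  -τ≈ratio*-s i = trans (-‿cong (sym ratio*s≈τ)) (-‿distribʳ-* _ _)
    where
    x y : Carrier
    x = √ξ i ⁻¹[ √ξ#0 i ]
    y = √s i ⁻¹[ √s#0 i ]
    ratio*s≈τ : √sξ-ratio i * s i ≈ τS i
    ratio*s≈τ = begin
      √s (suc i) * √ξ (suc i) * (√s i * √ξ i) ⁻¹[ _ ] * (√s i * √s i)
        ≈⟨ *-congʳ (*-congˡ (⁻¹-* (√s#0 i) (√ξ#0 i))) ⟩
      √s (suc i) * √ξ (suc i) * (y * x) * (√s i * √s i)
        ≈⟨ solve 5 (λ s′ ξ′ y x σ →
             ((s′ ⊕ ξ′) ⊕ (y ⊕ x)) ⊕ (σ ⊕ σ) ⊜ (y ⊕ σ) ⊕ (((s′ ⊕ ξ′) ⊕ σ) ⊕ x)) refl _ _ _ _ _ ⟩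
      y * √s i * τS i
        ≈⟨ *-congʳ (*-inverseˡ (√s#0 i)) ⟩
      1# * τS i
        ≈⟨ *-identityˡ _ ⟩
      τS i ∎

  -- Two signs are inserted to match the powers of `- κ` and `- s i`.
  κs/ξ*ξ : ∀ i → κs/ξ i * ξ i ≈ - κ * - s i
  κs/ξ*ξ i = begin
    κs/ξ i * ξ i       ≈⟨ /-*-cancel (ξ#0 i) ⟩
    κ * s i            ≈⟨ -‿involutive _ ⟨
    - (- (κ * s i))    ≈⟨ -‿cong (-‿distribʳ-* _ _) ⟩
    - (κ * - s i)      ≈⟨ -‿distribˡ-* _ _ ⟩
    - κ * - s i        ∎

  -- Factorisation of `𝔽` and comparison with the explicit formula

  module _ (lam μ : Partition) where

    a : ℕ → ℕ
    a i = part lam i ∸ part μ i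

    -- Indexed from 0: `edgeFactor 0` is the boundary factor of `𝔽`, and `edgeFactor (suc i)`
    -- belongs to the edge to the right of column `suc i`, whose other factor is `columnFactor i`.
    edgeFactor : ℕ → Carrier
    edgeFactor i = κs/ξ i ^ a i
                 * (⟨ s (suc i) * ξ (suc i) / κ [ κ#0 ] ⟩ (a i) / ⟨ q ⟩ (a i) [ qq#0 (a i) ])

    columnFactor : ℕ → Carrier
    columnFactor i =
        (⟨ κs/ξ (suc i) ⟩ e / ⟨ τS (suc i) * τS (suc i) ⟩ d [ τsτs#0 (suc i) d ])
      * (⟨ q ⟩ d / ⟨ q ⟩ e [ qq#0 e ])
      where
      d e : ℕ
      d = part μ i ∸ part μ (suc i)
      e = part μ i ∸ part lam (suc i)

    prefactor : Carrier
    prefactor = (-[ τS ]^ μ / -[ s ]^ lam [ -[s]^#0 lam ])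
              * (𝖼 τS μ / 𝖼 s lam [ 𝖼s#0 lam ])
              * κs/ξ 0 ^ a 0
              * (⟨ s 1 * ξ 1 / κ [ κ#0 ] ⟩ (a 0) / ⟨ q ⟩ (a 0) [ qq#0 (a 0) ])

    module _ (L : ℕ) (lλ<L : l lam < L) (lμ<L : l μ < L) where

      -- An admissible configuration would force interlacing, so every term of the lattice sum
      -- vanishes; if `part μ 0` exceeds `part lam 0`, the value is 0 by definition.
      ¬≺⇒𝔽≈0 : ¬ (μ ≺ lam) → 𝔽 L lam μ ≈ 0#
      ¬≺⇒𝔽≈0 μ⊀lam = if-cases (part μ 0 ≤? part lam 0)
        (λ μ₀≤λ₀ → trans (*-congˡ (∑∞-zero (config≈0 lam μ (a 0) L) (λ h →
          inadmissible⇒config≈0 lam μ L h (λ adm → μ⊀lam (admissible⇒≺ μ₀≤λ₀ adm lλ<L lμ<L)))))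
          (zeroʳ prefactor))
        refl

      module _ (μ≺lam : μ ≺ lam) where

        flow-vertex : ∀ c → vertices lam μ L (flow lam μ L) c
                            ≈ edgeFactor (suc (toℕ c)) * columnFactor (toℕ c)
        flow-vertex c =
          trans (≡⇒≈ (W-cong-≡ {t²#0 = t²#0 (suc i)} {τsτs#0 (suc i)} (m-conj-∸ μ i)
                       (≡.trans (lookup-flow lam μ L (inject₁ c)) (≡.cong a (toℕ-inject₁ c)))
                       (m-conj-∸ lam i) (lookup-flow lam μ L (Fin.suc c))))
            (trans (W-value (t²#0 (suc i)) (τsτs#0 (suc i)) (τ²/t² (suc i))
                     (∸-conserve (weakDecr μ i) (proj₁ (μ≺lam i))
                                 (proj₁ (μ≺lam (suc i))) (weakDecr lam i))
                     (∸-monoˡ-≤ (part μ (suc i)) (proj₂ (μ≺lam i)))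
                     (∸-∸-cancel (proj₁ (μ≺lam (suc i)))))
              -- `t²` multiplies ξ by s, whereas `edgeFactor` multiplies s by ξ.
              (*-congʳ (*-congˡ (*-congʳ (qPoch-cong (a (suc i)) (*-congʳ (*-comm _ _)))))))
          where
          i : ℕ
          i = toℕ c

        lam₊ μ₊ : Partition
        lam₊ = rebound lam L lλ<L
        μ₊   = rebound μ L lμ<L

        a-L : a L ≡ 0
        a-L = ∸≡0 (part μ L) (vanish lam₊ L ≤-refl)

        edgeFactor-L : edgeFactor L ≈ 1#
        edgeFactor-L rewrite a-L = trans (*-identityˡ _) (*-inverseʳ (qq#0 0))

        ZW-value : edgeFactor 0 * ZW lam μ (a 0) L ≈ ∏ℕ L (λ i → edgeFactor i * columnFactor i)
        ZW-value = begin
          edgeFactor 0 * ZW lam μ (a 0) L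
            ≈⟨ *-congˡ (∑∞-single (config≈0 lam μ (a 0) L) (flow lam μ L)
                 (λ h h≢flow → inadmissible⇒config≈0 lam μ L h
                   (h≢flow ∘ admissible⇒flow (proj₁ (μ≺lam 0))))
                 flow-bounded) ⟩
          edgeFactor 0 * config lam μ (a 0) L (flow lam μ L)
            ≈⟨ *-congˡ (*-cong (trans (*-cong (𝟙-yes (lookup (flow lam μ L) Fin.zero ≟ a 0) ≡.refl)
                                             (𝟙-yes (last (flow lam μ L) ≟ 0) flow-end))
                                      (*-identityˡ 1#))
                               (∏F-cong flow-vertex)) ⟩
          edgeFactor 0 * (1# * ∏ℕ L (λ i → edgeFactor (suc i) * columnFactor i))
            ≈⟨ *-congˡ (*-identityˡ _) ⟩
          edgeFactor 0 * ∏ℕ L (λ i → edgeFactor (suc i) * columnFactor i)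
            ≈⟨ ∏ℕ-telescope L edgeFactor columnFactor ⟩
          ∏ℕ L (λ i → edgeFactor i * columnFactor i) * edgeFactor L
            ≈⟨ trans (*-congˡ edgeFactor-L) (*-identityʳ _) ⟩
          ∏ℕ L (λ i → edgeFactor i * columnFactor i) ∎
          where
          flow-end : last (flow lam μ L) ≡ 0
          flow-end = ≡.trans (last-lookup (flow lam μ L)) (≡.trans (lookup-flow lam μ L (fromℕ L))
            (≡.trans (≡.cong a (toℕ-fromℕ L)) a-L))
          -- Since `part μ 0 ≤ part lam 0`, the box size is `suc (part lam 0)`, and every label is
          -- at most `part lam 0`.
          flow-bounded : ∀ i → lookup (flow lam μ L) i < suc (a 0 ℕ.+ part μ 0)
          flow-bounded i = s≤s (≤-trans (≤-reflexive (lookup-flow lam μ L i))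
            (≤-trans (m∸n≤m _ (part μ (toℕ i))) (≤-trans (part≤part₀ lam (toℕ i))
              (≤-reflexive (≡.sym (m∸n+n≡m (proj₁ (μ≺lam 0))))))))

        -- Cancelling `(- κ) ^ size μ` reduces this to natural exponents, where each part of λ
        -- splits as `a i` plus the part of μ.
        size-power : (- κ) ^ℤ size lam ⊖ size μ [ -#0 κ#0 ] ≈ ∏ℕ L (λ i → (- κ) ^ a i)
        size-power = *-cancelʳ (^#0 (size μ) (-#0 κ#0)) (begin
          (- κ) ^ℤ size lam ⊖ size μ [ -#0 κ#0 ] * (- κ) ^ size μ
            ≈⟨ ^ℤ-⊖ (-#0 κ#0) (size lam) (size μ) ⟩
          (- κ) ^ size lam
            ≈⟨ ^-size lam lλ<L ⟩
          ∏ℕ L (λ i → (- κ) ^ part lam i)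
            ≈⟨ ∏F-cong {L} (λ i → trans
                 (≡⇒≈ (≡.cong ((- κ) ^_) (≡.sym (m∸n+n≡m (proj₁ (μ≺lam (toℕ i)))))))
                 (^-homo-* (- κ) (a (toℕ i)) (part μ (toℕ i)))) ⟩
          ∏ℕ L (λ i → (- κ) ^ a i * (- κ) ^ part μ i)
            ≈⟨ ∏F-* {L} _ _ ⟩
          ∏ℕ L (λ i → (- κ) ^ a i) * ∏ℕ L (λ i → (- κ) ^ part μ i)
            ≈⟨ *-congˡ (^-size μ lμ<L) ⟨
          ∏ℕ L (λ i → (- κ) ^ a i) * (- κ) ^ size μ ∎)
          where
          ^-size : ∀ ν (lν<L : l ν < L) → (- κ) ^ size ν ≈ ∏ℕ L (λ i → (- κ) ^ part ν i)
          ^-size ν lν<L = trans (^-sum (- κ) (part ν) (bound ν))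
            (∏∞-irrelevant (λ i → (- κ) ^ part ν i) (λ i N≤i → ^≈1 (- κ) (vanish ν i N≤i))
              (λ i N≤i → ^≈1 (- κ) (vanish (rebound ν L lν<L) i N≤i)))

        s^#0 : ∀ i → negPowFactor s lam i # 0#
        s^#0 i = ^#0 (part lam i) (-#0 (s#0 i))

        cs#0 : ∀ i → cFactor s lam i # 0#
        cs#0 i = /#0 (ss#0 (suc i) d) (qq#0 d)
          where
          d : ℕ
          d = part lam i ∸ part lam (suc i)

        factor : ℕ → Carrier
        factor i = (negPowFactor τS μ i / negPowFactor s lam i [ s^#0 i ])
                 * (cFactor τS μ i / cFactor s lam i [ cs#0 i ])
                 * (edgeFactor i * columnFactor i)

        𝔽≈∏factor : 𝔽 L lam μ ≈ ∏ℕ L factor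
        𝔽≈∏factor = begin
          𝔽 L lam μ
            ≈⟨ if-yes (part μ 0 ≤? part lam 0) (proj₁ (μ≺lam 0)) ⟩
          prefactor * ZW lam μ (a 0) L
            -- Reassociation collects the last two factors of `prefactor` into `edgeFactor 0`.
            ≈⟨ trans (*-congʳ (*-assoc _ _ _)) (*-assoc _ _ _) ⟩
          (-[ τS ]^ μ / -[ s ]^ lam [ -[s]^#0 lam ]) * (𝖼 τS μ / 𝖼 s lam [ 𝖼s#0 lam ])
            * (edgeFactor 0 * ZW lam μ (a 0) L)
            -- Each product is moved from its own bound to `L`; only then do the quotients of
            -- products become products of quotients.
            ≈⟨ *-cong (*-cong
                 (trans (/-cong (∏∞-irrelevant _ (negPowFactor≈1 τS μ) (negPowFactor≈1 τS μ₊))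
                                (∏∞-irrelevant _ (negPowFactor≈1 s lam) (negPowFactor≈1 s lam₊)))
                        (∏F-/ {L} _ _ (s^#0 ∘ toℕ) (∏F#0 {L} (s^#0 ∘ toℕ))))
                 (trans (/-cong (∏∞-irrelevant _ (cFactor≈1 τS μ) (cFactor≈1 τS μ₊))
                                (∏∞-irrelevant _ (cFactor≈1 s lam) (cFactor≈1 s lam₊)))
                        (∏F-/ {L} _ _ (cs#0 ∘ toℕ) (∏F#0 {L} (cs#0 ∘ toℕ)))))
                 ZW-value ⟩
          ∏ℕ L (λ i → negPowFactor τS μ i / negPowFactor s lam i [ s^#0 i ])
            * ∏ℕ L (λ i → cFactor τS μ i / cFactor s lam i [ cs#0 i ])
            * ∏ℕ L (λ i → edgeFactor i * columnFactor i)
            ≈⟨ trans (∏F-* {L} _ _) (*-congʳ (∏F-* {L} _ _)) ⟨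
          ∏ℕ L factor ∎

        factor≈ : ∀ i → factor i ≈ (- κ) ^ a i * explicitFactor lam μ i
        factor≈ i = begin
          N * C * (κs/ξ i ^ a i * p * columnFactor i)
            ≈⟨ solve 5 (λ N C y p w → (N ⊕ C) ⊕ ((y ⊕ p) ⊕ w) ⊜ (N ⊕ y) ⊕ (C ⊕ (p ⊕ w))) refl
                 N C (κs/ξ i ^ a i) p (columnFactor i) ⟩
          N * κs/ξ i ^ a i * (C * (p * columnFactor i))
            ≈⟨ *-cong powers (poch-identity (ss#0 (suc i) (part lam i ∸ part lam (suc i)))) ⟩
          (- κ) ^ a i * (ξ i ^ℤ part μ i ⊖ part lam i [ ξ#0 i ] * √sξ-ratio i ^ part μ i) * _
            ≈⟨ *-assoc _ _ _ ⟩
          (- κ) ^ a i * explicitFactor lam μ i ∎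
          where
          N C p : Carrier
          N = negPowFactor τS μ i / negPowFactor s lam i [ s^#0 i ]
          C = cFactor τS μ i / cFactor s lam i [ cs#0 i ]
          p = ⟨ s (suc i) * ξ (suc i) / κ [ κ#0 ] ⟩ (a i) / ⟨ q ⟩ (a i) [ qq#0 (a i) ]
          powers : N * κs/ξ i ^ a i
                   ≈ (- κ) ^ a i * (ξ i ^ℤ part μ i ⊖ part lam i [ ξ#0 i ] * √sξ-ratio i ^ part μ i)
          -- The exponent `a i ℕ.+ part μ i` is replaced by `part lam i`. The type of the apartness
          -- proof mentions this exponent, so the motive quantifies over all such proofs.
          powers = ≡.subst
            (λ b → ∀ (b#0 : (- s i) ^ b # 0#) →
                   (- τS i) ^ part μ i / (- s i) ^ b [ b#0 ] * κs/ξ i ^ a i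
                   ≈ (- κ) ^ a i * (ξ i ^ℤ part μ i ⊖ b [ ξ#0 i ] * √sξ-ratio i ^ part μ i))
            (m∸n+n≡m (proj₁ (μ≺lam i)))
            (λ _ → power-identity (a i) (part μ i) (-#0 (s#0 i)) (ξ#0 i) (-τ≈ratio*-s i) (κs/ξ*ξ i))
            (s^#0 i)

        ≺⇒𝔽≈explicit : 𝔽 L lam μ ≈ explicit lam μ
        ≺⇒𝔽≈explicit = begin
          𝔽 L lam μ
            ≈⟨ 𝔽≈∏factor ⟩
          ∏ℕ L factor
            ≈⟨ ∏F-cong {L} (factor≈ ∘ toℕ) ⟩
          ∏ℕ L (λ i → (- κ) ^ a i * explicitFactor lam μ i)
            ≈⟨ ∏F-* {L} _ _ ⟩
          ∏ℕ L (λ i → (- κ) ^ a i) * ∏ℕ L (explicitFactor lam μ)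
            -- `lam₊` and `μ₊` both have bound `L`, so they certify that the explicit factors are 1
            -- from `L` on.
            ≈⟨ *-cong (sym size-power) (∏∞-irrelevant (explicitFactor lam μ) {L}
                 (λ i L≤i → explicitFactor≈1 lam₊ μ₊ i (⊔-lub L≤i L≤i)) (explicitFactor≈1 lam μ)) ⟩
          explicit lam μ ∎

proposition5p6 : ∀ {c ℓ₁ ℓ₂} (K : HeytingField c ℓ₁ ℓ₂) (P : Parameters K) →
    let open Functions K P in
    (lam μ : Partition) (L : ℕ) → l lam < L → l μ < L →
    (μ ≺ lam → 𝔽 L lam μ ≈ explicit lam μ) ×
    (¬ (μ ≺ lam) → 𝔽 L lam μ ≈ 0#)
proposition5p6 K P lam μ L lλ<L lμ<L =
  ≺⇒𝔽≈explicit K P lam μ L lλ<L lμ<L , ¬≺⇒𝔽≈0 K P lam μ L lλ<L lμ<L
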